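{- Let $G$ be a simple graph of order $n\geq 4$ such that both $G$ and its complement $\overline{G}$ are connected. Then $trc(G)+trc(\overline{G})=2n+2$ if $n=4$; $trc(G)+trc(\overline{G})\leq 2n+1$ if $n=5$; and $trc(G)+trc(\overline{G})\leq 2n$ if $n\geq 6$. Moreover, these upper bounds are tight: for every $n\geq 5$ there exists a graph $G$ of order $n$ with $G$ and $\overline{G}$ connected attaining the corresponding bound.
   Context: All graphs are finite, simple and undirected. A total-coloring of a graph assigns colors to all its vertices and edges. In a total-colored graph, a path is total-rainbow if all its edges and all its internal vertices receive pairwise distinct colors. The graph is total-rainbow connected if every pair of distinct vertices is joined by a total-rainbow path. For a connected graph $G$, the total-rainbow connection number $trc(G)$ is the minimum number of colors in a total-coloring of $G$ making $G$ total-rainbow connected. -}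

module Defs where

open import Data.Nat using (ℕ; _<_)
open import Data.Fin using (Fin; _≟_)
open import Data.Bool using (Bool; true; false; not; if_then_else_)
open import Data.List using (List; []; _∷_; _++_; map; last)
open import Data.List.Relation.Unary.Unique.Propositional using (Unique)
open import Data.Maybe using (Maybe; just)
open import Data.Product using (Σ; ∃; _×_; _,_)
open import Data.Unit using (⊤)
open import Relation.Nullary using (¬_; Dec; yes; no)
open import Relation.Binary.PropositionalEquality using (_≡_; refl; sym; cong)
open import Data.Empty using (⊥-elim)

record Graph (n : ℕ) : Set where
  field
    adj    : Fin n → Fin n → Bool
    adjSym : ∀ u v → adj u v ≡ adj v u
    adjIrrefl : ∀ u → adj u u ≡ false
open Graph public

compAdj : ∀ {n} → Graph n → Fin n → Fin n → Bool
compAdj G u v with u ≟ v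
... | yes _ = false
... | no  _ = not (adj G u v)

compSym : ∀ {n} (G : Graph n) u v → compAdj G u v ≡ compAdj G v u
compSym G u v with u ≟ v | v ≟ u
... | yes _ | yes _ = refl
... | yes p | no ¬q = ⊥-elim (¬q (sym p))
... | no ¬p | yes q = ⊥-elim (¬p (sym q))
... | no _  | no _  = cong not (adjSym G u v)

compIrrefl : ∀ {n} (G : Graph n) u → compAdj G u u ≡ false
compIrrefl G u with u ≟ u
... | yes _ = refl
... | no ¬p = ⊥-elim (¬p refl)

complement : ∀ {n} → Graph n → Graph n
complement G = record { adj = compAdj G ; adjSym = compSym G ; adjIrrefl = compIrrefl G }

Consec : ∀ {n} → Graph n → List (Fin n) → Set
Consec G []            = ⊤
Consec G (x ∷ [])      = ⊤
Consec G (x ∷ y ∷ r)   = adj G x y ≡ true × Consec G (y ∷ r)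

IsPath : ∀ {n} → Graph n → Fin n → Fin n → List (Fin n) → Set
IsPath G u v ps = Σ (List (Fin _)) (λ rest → ps ≡ u ∷ rest)
                × last ps ≡ just v × Unique ps × Consec G ps

Connected : ∀ {n} → Graph n → Set
Connected {n} G = ∀ (u v : Fin n) → ¬ u ≡ v → ∃ λ ps → IsPath G u v ps

record TotalColoring {n : ℕ} (G : Graph n) (k : ℕ) : Set where
  field
    vcol    : Fin n → Fin k
    ecol    : Fin n → Fin n → Fin k
    ecolSym : ∀ u v → ecol u v ≡ ecol v u
open TotalColoring public

edgeCols : ∀ {n k} {G : Graph n} → TotalColoring G k → List (Fin n) → List (Fin k)
edgeCols c (x ∷ y ∷ r) = ecol c x y ∷ edgeCols c (y ∷ r)
edgeCols c _           = []

dropLast : ∀ {A : Set} → List A → List A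
dropLast []          = []
dropLast (x ∷ [])    = []
dropLast (x ∷ y ∷ r) = x ∷ dropLast (y ∷ r)

interior : ∀ {A : Set} → List A → List A
interior []       = []
interior (x ∷ xs) = dropLast xs

TotalRainbow : ∀ {n k} {G : Graph n} → TotalColoring G k → List (Fin n) → Set
TotalRainbow c ps = Unique (edgeCols c ps ++ map (vcol c) (interior ps))

TotalRainbowConnected : ∀ {n k} {G : Graph n} → TotalColoring G k → Set
TotalRainbowConnected {n} {G = G} c =
  ∀ (u v : Fin n) → ¬ u ≡ v → ∃ λ ps → IsPath G u v ps × TotalRainbow c ps

TRCWith : ∀ {n} → Graph n → ℕ → Set
TRCWith G k = Σ (TotalColoring G k) TotalRainbowConnected

IsTrc : ∀ {n} → Graph n → ℕ → Set
IsTrc G k = TRCWith G k × (∀ j → j < k → ¬ TRCWith G j)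

{-# OPTIONS --safe #-}
module Submission where

-- Upper bound: vertices are added one at a time to an induced P₄, keeping both graphs connected,
-- and each new vertex v raises the sum of the numbers of colours by at most 2.  Two new colours
-- always suffice in one graph (one for the edges at v, one for a neighbour of v).  No new colour is
-- needed in the other graph when v is within distance two of all vertices and there are sufficiently
-- many colours; if there are too few of them, colouring a suitable spanning tree gives the bound
-- directly.  On five vertices the sum is at most 10, except for the fork and its complement where
-- it is 11, and all one-vertex extensions of these two graphs are coloured explicitly.
-- Sharpness: for n ≥ 6 the path needs 2n − 3 colours and its complement 3; for n = 5 take the fork.

open import Defs
open import Data.Bool using (Bool; true; false; not)
import Data.Bool as Bool
open import Data.Bool.Properties using (not-involutive; ¬-not; ∨-comm)
open import Data.Empty using (⊥; ⊥-elim)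
open import Data.Fin using (Fin; zero; suc; toℕ; fromℕ; fromℕ<; inject₁; _≟_)
open import Data.Fin.Induction using (<-weakInduction)
import Data.Fin.Properties as FinP
open import Data.Fin.Properties using (toℕ-fromℕ<; toℕ-fromℕ; toℕ-inject₁)
open import Data.List using (List; []; _∷_; _++_; map; length; reverse; _∷ʳ_; [_]; upTo; filter; concatMap; allFin; lookup; last)
open import Data.List.Membership.Propositional using (_∈_; _∉_; find; lose)
open import Data.List.Membership.Propositional.Properties using (∈-∃++; ∈-map⁺; ∈-map⁻; ∈-++⁺ˡ; ∈-++⁺ʳ; ∈-++⁻; ∈-upTo⁻; ∈-filter⁺; ∈-filter⁻; ∈-lookup; ∈-allFin)
import Data.List.Membership.DecPropositional
open import Data.List.Properties using (map-cong-local; unfold-reverse; ++-assoc; length-++; length-map; length-upTo; length-tabulate; map-∘; map-cong; ≡-dec)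
open import Data.List.Relation.Binary.Permutation.Propositional using (_↭_; ↭-refl; ↭-sym; ↭-trans; ↭-prep; ↭-swap; ↭-reflexive; ↭⇒↭ₛ)
import Data.List.Relation.Binary.Permutation.Propositional.Properties as Perm
open import Data.List.Relation.Binary.Permutation.Propositional.Properties using (shift; ∈-resp-↭; All-resp-↭; ↭-length; ↭-reverse)
import Data.List.Relation.Binary.Permutation.Setoid.Properties as PermS
open import Data.List.Relation.Binary.Subset.Propositional using (_⊆_)
open import Data.List.Relation.Unary.All using (All; []; _∷_)
import Data.List.Relation.Unary.All as All
import Data.List.Relation.Unary.All.Properties as AllP
open import Data.List.Relation.Unary.AllPairs using ([]; _∷_)
import Data.List.Relation.Unary.AllPairs as AllPairs
import Data.List.Relation.Unary.AllPairs.Properties as AllPairsP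
open import Data.List.Relation.Unary.Any using (Any; here; there; index)
import Data.List.Relation.Unary.Any as Any
open import Data.List.Relation.Unary.Any.Properties using (lookup-index)
import Data.List.Relation.Unary.Unique.DecPropositional as DecUnique
open import Data.List.Relation.Unary.Unique.Propositional using (Unique)
import Data.List.Relation.Unary.Unique.Propositional.Properties as UniqueP
open import Data.List.Relation.Unary.Unique.Propositional.Properties using (Unique[x∷xs]⇒x∉xs)
open import Data.Maybe using (just)
import Data.Maybe.Properties as MaybeP
open import Data.Nat using (ℕ; zero; suc; _+_; _*_; _∸_; _/_; _%_; _≤_; _<_; _≤?_; _<?_; z≤n; s≤s; s≤s⁻¹)
import Data.Nat as ℕ
open import Data.Nat.Properties hiding (_≟_; _≤?_; _<?_)
open import Data.Nat.Solver using (module +-*-Solver)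
open import Data.Product using (Σ; ∃; ∃₂; _×_; _,_; proj₁; proj₂)
open import Data.Sum using (_⊎_; inj₁; inj₂)
open import Data.Unit using (⊤; tt)
open import Data.Vec using (Vec; []; _∷_; replicate)
import Data.Vec as Vec
import Data.Vec.Properties as VecP
open import Function using (_∘_)
open import Relation.Binary.PropositionalEquality hiding ([_])
open import Relation.Nullary using (¬_; Dec; yes; no; ¬?; does)
open import Relation.Nullary.Decidable using (False; toWitness; toWitnessFalse; decidable-stable; map′; dec-true; dec-false; _×-dec_; _⊎-dec_; _→-dec_)
open import Relation.Unary using (Decidable)

-- The induction maintains a sum of at most 2|S|. It cannot start at P₄, where both numbers are 5
-- and the sum exceeds 2|S| by two. A step that adds two passes an excess on and never removes it,
-- so the base of the induction is moved up to six vertices. Growing an induced P₄ within the graph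
-- can get stuck: every outside vertex may be joined to all or to none of the set T reached so far.
-- Either way a vertex is found whose removal leaves a smaller instance. In a step, let v have d
-- neighbours in G and e in the complement H, so that d + e = |S|. An edge at v has about e colours
-- to avoid in G and about d in H; "sufficiently many colours" means more than that. The delicate
-- case is a vertex y at distance at least three from v in G. Two-step paths then fail in G, but in
-- H this y is joined to v and to all d vertices that v misses there.

module ℕMem = Data.List.Membership.DecPropositional ℕ._≟_
module VMem {n} = Data.List.Membership.DecPropositional (_≟_ {n})

private variable
  n k k′ m : ℕ

-- Permutations of lists and fresh colours

Unique-resp-↭ : {A : Set} {xs ys : List A} → xs ↭ ys → Unique xs → Unique ys
Unique-resp-↭ p = PermS.Unique-resp-↭ (setoid _) (↭⇒↭ₛ p)

∈⇒↭ : {A : Set} {x : A} {xs : List A} → x ∈ xs → ∃ λ ys → xs ↭ x ∷ ys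
∈⇒↭ x∈xs with as , bs , refl ← ∈-∃++ x∈xs = as ++ bs , shift _ as bs

unique-⊆⇒length≤ : {A : Set} {xs ys : List A} → Unique xs → xs ⊆ ys → length xs ≤ length ys
unique-⊆⇒length≤ []          _     = z≤n
unique-⊆⇒length≤ {xs = x ∷ xs} {ys} ux@(_ ∷ u) xs⊆ys with zs , p ← ∈⇒↭ (xs⊆ys (here refl)) =
  subst (suc (length xs) ≤_) (sym (↭-length p)) (s≤s (unique-⊆⇒length≤ u sub))
  where
  sub : xs ⊆ zs
  sub y∈ with ∈-resp-↭ p (xs⊆ys (there y∈))
  ... | here refl = ⊥-elim (Unique[x∷xs]⇒x∉xs ux y∈)
  ... | there q   = q

freshColour : (xs : List ℕ) → length xs < k → ∃ λ c → c < k × c ∉ xs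
freshColour {k} xs len with Any.any? (λ c → ¬? (c ℕMem.∈? xs)) (upTo k)
... | yes p with c , c∈ , c∉ ← find p = c , ∈-upTo⁻ c∈ , c∉
... | no ¬p = ⊥-elim (<⇒≱ len (subst (_≤ length xs) (length-upTo k)
  (unique-⊆⇒length≤ (UniqueP.upTo⁺ k) λ {c} c∈ → decidable-stable (c ℕMem.∈? xs) λ c∉ → ¬p (lose c∈ c∉))))

-- Rainbow paths and colourings on a set of vertices

data Item (n : ℕ) : Set where
  edge : Fin n → Fin n → Item n
  vert : Fin n → Item n

flip-edge : Item n → Item n
flip-edge (edge u w) = edge w u
flip-edge (vert u)   = vert u

-- Edges and internal vertices are interleaved in the order of the path, so that a path is prolonged
-- at its front by putting two items before the list.
items : Fin n → List (Fin n) → Fin n → List (Item n)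
items u []       w = edge u w ∷ []
items u (y ∷ ys) w = edge u y ∷ vert y ∷ items y ys w

items-∷ʳ : (u : Fin n) (ys : List (Fin n)) (y w : Fin n) →
           items u (ys ∷ʳ y) w ≡ items u ys y ++ vert y ∷ edge y w ∷ []
items-∷ʳ u []       y w = refl
items-∷ʳ u (x ∷ ys) y w = cong (λ l → edge u x ∷ vert x ∷ l) (items-∷ʳ x ys y w)

items-reverse : (u : Fin n) (ys : List (Fin n)) (w : Fin n) →
                items w (reverse ys) u ≡ reverse (map flip-edge (items u ys w))
items-reverse u []       w = refl
items-reverse u (y ∷ ys) w = begin
  items w (reverse (y ∷ ys)) u
    ≡⟨ cong (λ l → items w l u) (unfold-reverse y ys) ⟩
  items w (reverse ys ∷ʳ y) u
    ≡⟨ items-∷ʳ w (reverse ys) y u ⟩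
  items w (reverse ys) y ++ vert y ∷ edge y u ∷ []
    ≡⟨ cong (_++ vert y ∷ edge y u ∷ []) (items-reverse y ys w) ⟩
  reverse L ++ vert y ∷ edge y u ∷ []
    ≡⟨ ++-assoc (reverse L) [ vert y ] [ edge y u ] ⟨
  (reverse L ∷ʳ vert y) ∷ʳ edge y u
    ≡⟨ cong (_∷ʳ edge y u) (unfold-reverse (vert y) L) ⟨
  reverse (vert y ∷ L) ∷ʳ edge y u
    ≡⟨ unfold-reverse (edge y u) (vert y ∷ L) ⟨
  reverse (edge y u ∷ vert y ∷ L) ∎
  where
  open ≡-Reasoning
  L = map flip-edge (items y ys w)

items-All : {P : Item n → Set} {Q : Fin n → Set} →
            (∀ {x y} → Q x → Q y → P (edge x y)) → (∀ {x} → Q x → P (vert x)) →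
            ∀ {u ys w} → Q u → All Q ys → Q w → All P (items u ys w)
items-All pe pv qu []         qw = pe qu qw ∷ []
items-All pe pv qu (qy ∷ qys) qw = pe qu qy ∷ pv qy ∷ items-All pe pv qy qys qw

-- Colours are natural numbers, bounded only in `Connecting`: enlarging the number of colours then
-- leaves the colouring itself untouched.
record Colouring (n : ℕ) : Set where
  constructor colouring
  field
    col    : Item n → ℕ
    colSym : ∀ u w → col (edge u w) ≡ col (edge w u)
open Colouring public

IsEdge : (Fin n → Fin n → Bool) → Item n → Set
IsEdge A (edge u w) = A u w ≡ true
IsEdge A (vert _)   = ⊤

-- The distinctness of the internal vertices follows from that of their colours.
record RainbowPath (G : Graph n) (c : Item n → ℕ) (S : List (Fin n)) (u w : Fin n) : Set where
  constructor rainbowPath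
  field
    mid     : List (Fin n)
    walk    : All (IsEdge (adj G)) (items u mid w)
    u∉mid   : u ∉ mid
    w∉mid   : w ∉ mid
    mid∈S   : All (_∈ S) mid
    rainbow : Unique (map c (items u mid w))
open RainbowPath public

-- The condition proper makes v, z, u total-rainbow for a new vertex v as soon as the colour of
-- the new edge vz is suitable.
record Connecting (G : Graph n) (c : Colouring n) (k : ℕ) (S : List (Fin n)) : Set where
  field
    col<k  : ∀ i → col c i < k
    proper : ∀ {u w} → u ∈ S → w ∈ S → adj G u w ≡ true → col c (vert u) ≢ col c (edge u w)
    path   : ∀ {u w} → u ∈ S → w ∈ S → u ≢ w → RainbowPath G (col c) S u w
open Connecting public

Colourable : Graph n → ℕ → List (Fin n) → Set
Colourable G k S = ∃ λ c → Connecting G c k S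

reversePath : {G : Graph n} {c : Colouring n} {S : List (Fin n)} {u w : Fin n} →
              RainbowPath G (col c) S u w → RainbowPath G (col c) S w u
reversePath {G = G} {c} {S} {u} {w} p = record
  { mid     = reverse (mid p)
  ; walk    = subst (All (IsEdge (adj G))) (sym eq)
                (All-resp-↭ (↭-sym (↭-reverse _)) (AllP.map⁺ (All.map flipAdj (walk p))))
  ; u∉mid   = w∉mid p ∘ ∈-resp-↭ (↭-reverse (mid p))
  ; w∉mid   = u∉mid p ∘ ∈-resp-↭ (↭-reverse (mid p))
  ; mid∈S   = All-resp-↭ (↭-sym (↭-reverse (mid p))) (mid∈S p)
  ; rainbow = Unique-resp-↭ (↭-sym perm) (rainbow p)
  }
  where
  eq = items-reverse u (mid p) w
  flipAdj : ∀ {i} → IsEdge (adj G) i → IsEdge (adj G) (flip-edge i)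
  flipAdj {edge x y} e = trans (adjSym G y x) e
  flipAdj {vert x}   e = e
  flipCol : ∀ i → col c (flip-edge i) ≡ col c i
  flipCol (edge x y) = colSym c y x
  flipCol (vert x)   = refl
  its = items u (mid p) w
  perm : map (col c) (items w (reverse (mid p)) u) ↭ map (col c) its
  perm = ↭-trans (↭-reflexive (cong (map (col c)) eq))
        (↭-trans (Perm.map⁺ (col c) (↭-reverse (map flip-edge its)))
                 (↭-reflexive (trans (sym (map-∘ its)) (map-cong flipCol its))))

recolourPath : {G : Graph n} {c c′ : Item n → ℕ} {S S′ : List (Fin n)} {u w : Fin n} →
               S ⊆ S′ → (p : RainbowPath G c S u w) →
               map c′ (items u (mid p) w) ≡ map c (items u (mid p) w) → RainbowPath G c′ S′ u w
recolourPath S⊆ p eq = record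
  { RainbowPath p hiding (mid∈S; rainbow)
  ; mid∈S   = All.map S⊆ (mid∈S p)
  ; rainbow = subst Unique (sym eq) (rainbow p)
  }

directPath : {G : Graph n} {c : Item n → ℕ} {S : List (Fin n)} {u w : Fin n} →
             adj G u w ≡ true → RainbowPath G c S u w
directPath uw = rainbowPath [] (uw ∷ []) (λ ()) (λ ()) [] ([] ∷ [])

consPath : {G : Graph n} {c : Item n → ℕ} {S : List (Fin n)} {v w u : Fin n} →
           adj G v w ≡ true → (p : RainbowPath G c S w u) → v ≢ w → u ≢ w → v ∉ mid p → w ∈ S →
           All (c (edge v w) ≢_) (c (vert w) ∷ map c (items w (mid p) u)) →
           All (c (vert w) ≢_) (map c (items w (mid p) u)) →
           RainbowPath G c S v u
consPath vw p v≢w u≢w v∉ w∈S e≢ v≢ = record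
  { mid     = _ ∷ mid p
  ; walk    = vw ∷ _ ∷ walk p
  ; u∉mid   = λ { (here eq) → v≢w eq ; (there q) → v∉ q }
  ; w∉mid   = λ { (here eq) → u≢w eq ; (there q) → w∉mid p q }
  ; mid∈S   = w∈S ∷ mid∈S p
  ; rainbow = e≢ ∷ v≢ ∷ rainbow p
  }

Colourable-≤ : {G : Graph n} {S : List (Fin n)} → k ≤ k′ → Colourable G k S → Colourable G k′ S
Colourable-≤ k≤k′ (c , t) = c , record { Connecting t hiding (col<k) ; col<k = λ i → <-≤-trans (col<k t i) k≤k′ }

Connecting-resp : {G : Graph n} {c : Colouring n} {S S′ : List (Fin n)} → S ⊆ S′ → S′ ⊆ S →
                  Connecting G c k S → Connecting G c k S′
Connecting-resp S⊆ ⊆S t = record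
  { col<k  = col<k t
  ; proper = λ u∈ w∈ → proper t (⊆S u∈) (⊆S w∈)
  ; path   = λ u∈ w∈ u≢w → recolourPath S⊆ (path t (⊆S u∈) (⊆S w∈) u≢w) refl
  }

Colourable-↭ : {G : Graph n} {S S′ : List (Fin n)} → S ↭ S′ → Colourable G k S → Colourable G k S′
Colourable-↭ p (c , t) = c , Connecting-resp (∈-resp-↭ p) (∈-resp-↭ (↭-sym p)) t

-- Colouring a new vertex and its edges

addVertex : Colouring n → Fin n → ℕ → (Fin n → ℕ) → Colouring n
addVertex {n} c v γ f = colouring new newSym
  where
  newEdge : (u w : Fin n) → Dec (u ≡ v) → Dec (w ≡ v) → ℕ
  newEdge u w (yes _) _       = f w
  newEdge u w (no _)  (yes _) = f u
  newEdge u w (no _)  (no _)  = col c (edge u w)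
  newVert : (u : Fin n) → Dec (u ≡ v) → ℕ
  newVert u (yes _) = γ
  newVert u (no _)  = col c (vert u)
  new : Item n → ℕ
  new (edge u w) = newEdge u w (u ≟ v) (w ≟ v)
  new (vert u)   = newVert u (u ≟ v)
  newSym : ∀ u w → new (edge u w) ≡ new (edge w u)
  newSym u w with u ≟ v | w ≟ v
  ... | yes refl | yes refl = refl
  ... | yes _    | no _     = refl
  ... | no _     | yes _    = refl
  ... | no _     | no _     = colSym c u w

module _ (c : Colouring n) (v : Fin n) (γ : ℕ) (f : Fin n → ℕ) where

  private c⁺ = col (addVertex c v γ f)

  addVertex-vert : c⁺ (vert v) ≡ γ
  addVertex-vert with v ≟ v
  ... | yes _ = refl
  ... | no ¬p = ⊥-elim (¬p refl)

  addVertex-edge : ∀ w → c⁺ (edge v w) ≡ f w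
  addVertex-edge w with v ≟ v
  ... | yes _ = refl
  ... | no ¬p = ⊥-elim (¬p refl)

  addVertex-old-edge : ∀ {u w} → u ≢ v → w ≢ v → c⁺ (edge u w) ≡ col c (edge u w)
  addVertex-old-edge {u} {w} u≢v w≢v with u ≟ v | w ≟ v
  ... | yes p | _     = ⊥-elim (u≢v p)
  ... | no _  | yes q = ⊥-elim (w≢v q)
  ... | no _  | no _  = refl

  addVertex-old-vert : ∀ {u} → u ≢ v → c⁺ (vert u) ≡ col c (vert u)
  addVertex-old-vert {u} u≢v with u ≟ v
  ... | yes p = ⊥-elim (u≢v p)
  ... | no _  = refl

  addVertex-bound : k ≤ k′ → γ < k′ → (∀ w → f w < k′) → (∀ i → col c i < k) → ∀ i → c⁺ i < k′
  addVertex-bound k≤k′ γ< f< c< (edge u w) with u ≟ v | w ≟ v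
  ... | yes _ | _     = f< w
  ... | no _  | yes _ = f< u
  ... | no _  | no _  = <-≤-trans (c< (edge u w)) k≤k′
  addVertex-bound k≤k′ γ< f< c< (vert u) with u ≟ v
  ... | yes _ = γ<
  ... | no _  = <-≤-trans (c< (vert u)) k≤k′

  addVertex-old-items : ∀ {S u ys w} → v ∉ S → u ∈ S → All (_∈ S) ys → w ∈ S →
                        map c⁺ (items u ys w) ≡ map (col c) (items u ys w)
  addVertex-old-items v∉S u∈ ys∈ w∈ = map-cong-local
    (items-All addVertex-old-edge addVertex-old-vert (≢v u∈) (All.map ≢v ys∈) (≢v w∈))
    where
    ≢v : ∀ {x} → x ∈ _ → x ≢ v
    ≢v x∈ refl = v∉S x∈

  addVertex-old-path : ∀ {G S u w} → v ∉ S → u ∈ S → w ∈ S → RainbowPath G (col c) S u w →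
                       RainbowPath G c⁺ (v ∷ S) u w
  addVertex-old-path v∉S u∈ w∈ p =
    recolourPath there p (addVertex-old-items v∉S u∈ (mid∈S p) w∈)

  -- Paths between old vertices have their interior in S and keep all their colours, so only the
  -- paths from v have to be supplied; the reverse ones follow.
  addVertex-connecting : ∀ {G S} → v ∉ S → k ≤ k′ → γ < k′ → (∀ w → f w < k′) →
    (∀ {z} → z ∈ S → adj G v z ≡ true → f z ≢ γ × f z ≢ col c (vert z)) →
    (∀ {u} → u ∈ S → RainbowPath G c⁺ (v ∷ S) v u) →
    Connecting G c k S → Connecting G (addVertex c v γ f) k′ (v ∷ S)
  addVertex-connecting {G = G} {S} v∉S k≤k′ γ< f< ok vpath t = record
    { col<k  = addVertex-bound k≤k′ γ< f< (col<k t)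
    ; proper = proper⁺
    ; path   = path⁺
    }
    where
    ≢v : ∀ {x} → x ∈ S → x ≢ v
    ≢v x∈ refl = v∉S x∈
    proper⁺ : ∀ {u w} → u ∈ v ∷ S → w ∈ v ∷ S → adj G u w ≡ true → c⁺ (vert u) ≢ c⁺ (edge u w)
    proper⁺ (here refl) (here refl) e _ with () ← trans (sym e) (adjIrrefl G v)
    proper⁺ {w = w} (here refl) (there w∈) e eq =
      proj₁ (ok w∈ e) (sym (trans (sym addVertex-vert) (trans eq (addVertex-edge w))))
    proper⁺ {u} (there u∈) (here refl) e eq =
      proj₂ (ok u∈ (trans (adjSym G v u) e))
        (sym (trans (sym (addVertex-old-vert (≢v u∈)))
          (trans eq (trans (colSym (addVertex c v γ f) u v) (addVertex-edge u)))))
    proper⁺ (there u∈) (there w∈) e eq =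
      proper t u∈ w∈ e (trans (sym (addVertex-old-vert (≢v u∈)))
                         (trans eq (addVertex-old-edge (≢v u∈) (≢v w∈))))
    path⁺ : ∀ {u w} → u ∈ v ∷ S → w ∈ v ∷ S → u ≢ w → RainbowPath G c⁺ (v ∷ S) u w
    path⁺ (here refl) (here refl) ne = ⊥-elim (ne refl)
    path⁺ (here refl) (there w∈)  ne = vpath w∈
    path⁺ (there u∈)  (here refl) ne = reversePath {c = addVertex c v γ f} (vpath u∈)
    path⁺ (there u∈)  (there w∈)  ne = addVertex-old-path v∉S u∈ w∈ (path t u∈ w∈ ne)

-- No colour is added. On v, w, u the three colours are those of vw, w and wu: the first differs
-- from the others by choice of `f`, and the last two differ by `proper`.
addVertex-two-step : {G : Graph n} {c : Colouring n} {S : List (Fin n)} (v : Fin n) (γ : ℕ) (f : Fin n → ℕ) →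
  Connecting G c k S → v ∉ S → γ < k → (∀ w → f w < k) →
  (∀ {z} → z ∈ S → f z ≢ γ × f z ≢ col c (vert z)) →
  (∀ {u} → u ∈ S → adj G v u ≡ true ⊎
     ∃ λ w → w ∈ S × adj G v w ≡ true × adj G w u ≡ true × f w ≢ col c (edge w u)) →
  Colourable G k (v ∷ S)
addVertex-two-step {G = G} {c} {S} v γ f t v∉S γ< f< ok reach =
  addVertex c v γ f , addVertex-connecting c v γ f v∉S ≤-refl γ< f< (λ z∈ _ → ok z∈) vpath t
  where
  ≢v : ∀ {x} → x ∈ S → x ≢ v
  ≢v x∈ refl = v∉S x∈
  vpath : ∀ {u} → u ∈ S → RainbowPath G (col (addVertex c v γ f)) (v ∷ S) v u
  vpath {u} u∈ with reach u∈
  ... | inj₁ e = directPath e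
  ... | inj₂ (w , w∈ , vw , wu , f≢) =
    consPath vw (directPath wu) (≢v w∈ ∘ sym) u≢w (λ ()) (there w∈)
      ((λ eq → proj₂ (ok w∈) (trans (sym fw) (trans eq cw))) ∷
       (λ eq → f≢ (trans (sym fw) (trans eq cwu))) ∷ [])
      ((λ eq → proper t w∈ u∈ wu (trans (sym cw) (trans eq cwu))) ∷ [])
    where
    u≢w : u ≢ w
    u≢w refl with () ← trans (sym wu) (adjIrrefl G u)
    fw = addVertex-edge c v γ f w
    cw = addVertex-old-vert c v γ f (≢v w∈)
    cwu = addVertex-old-edge c v γ f (≢v w∈) (≢v u∈)

-- Saturated vertices, stars and pendant vertices

-- Attaching a new vertex at a saturated vertex costs a single colour.
Saturated : Graph n → Colouring n → List (Fin n) → Fin n → Set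
Saturated G c S w = ∀ {u} → u ∈ S → u ≢ w →
  Σ (RainbowPath G (col c) S w u) λ p → All (col c (vert w) ≢_) (map (col c) (items w (mid p) u))

SatColourable : Graph n → ℕ → List (Fin n) → Fin n → Set
SatColourable G k S w = ∃ λ c → Connecting G c k S × Saturated G c S w

singleton-colourable : (G : Graph n) (w : Fin n) → SatColourable G 1 (w ∷ []) w
singleton-colourable G w = colouring (λ _ → 0) (λ _ _ → refl) ,
  record { col<k = λ _ → s≤s z≤n
         ; proper = λ { (here refl) (here refl) e _ → loop e }
         ; path = λ { (here refl) (here refl) ne → ⊥-elim (ne refl) } } ,
  λ { (here refl) ne → ⊥-elim (ne refl) }
  where
  loop : adj G w w ≡ true → ⊥
  loop e with () ← trans (sym e) (adjIrrefl G w)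

-- Giving w alone the fresh colour k merges no two colours, so rainbow paths stay rainbow. A path
-- starting at w does not have w in its interior, hence avoids the new colour.
saturate : {G : Graph n} {S : List (Fin n)} (w : Fin n) → w ∈ S →
           Colourable G k S → SatColourable G (suc k) S w
saturate {n} {k} {G} {S} w w∈ (c , t) = c⁺ , t⁺ , sat
  where
  newVert : (u : Fin n) → Dec (u ≡ w) → ℕ
  newVert u (yes _) = k
  newVert u (no _)  = col c (vert u)
  new : Item n → ℕ
  new (edge u v) = col c (edge u v)
  new (vert u)   = newVert u (u ≟ w)
  c⁺ = colouring new (colSym c)
  new-w : new (vert w) ≡ k
  new-w with w ≟ w
  ... | yes _ = refl
  ... | no ¬p = ⊥-elim (¬p refl)
  bound : ∀ i → new i < suc k
  bound (edge u v) = m<n⇒m<1+n (col<k t (edge u v))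
  bound (vert u) with u ≟ w
  ... | yes _ = n<1+n k
  ... | no _  = m<n⇒m<1+n (col<k t (vert u))
  refines : ∀ i j → new i ≡ new j → col c i ≡ col c j
  refines (edge _ _) (edge _ _) eq = eq
  refines (edge x y) (vert u) eq with u ≟ w
  ... | yes _ = ⊥-elim (<⇒≢ (col<k t (edge x y)) eq)
  ... | no _  = eq
  refines (vert u) (edge x y) eq with u ≟ w
  ... | yes _ = ⊥-elim (<⇒≢ (col<k t (edge x y)) (sym eq))
  ... | no _  = eq
  refines (vert u) (vert x) eq with u ≟ w | x ≟ w
  ... | yes refl | yes refl = refl
  ... | yes _    | no _     = ⊥-elim (<⇒≢ (col<k t (vert x)) (sym eq))
  ... | no _     | yes _    = ⊥-elim (<⇒≢ (col<k t (vert u)) eq)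
  ... | no _     | no _     = eq
  refine : ∀ {u v} → RainbowPath G (col c) S u v → RainbowPath G new S u v
  refine p = record
    { RainbowPath p hiding (rainbow)
    ; rainbow = AllPairsP.map⁺ (AllPairs.map (λ {i} {j} ne eq → ne (refines i j eq)) (AllPairsP.map⁻ (rainbow p)))
    }
  t⁺ : Connecting G c⁺ (suc k) S
  t⁺ = record
    { col<k  = bound
    ; proper = λ {u} {v} u∈ v∈ e eq → proper t u∈ v∈ e (refines (vert u) (edge u v) eq)
    ; path   = λ u∈ v∈ ne → refine (path t u∈ v∈ ne)
    }
  k≢ : ∀ {i} → i ≢ vert w → new (vert w) ≢ new i
  k≢ {edge x y} _ eq = <⇒≢ (col<k t (edge x y)) (trans (sym eq) new-w)
  k≢ {vert u} ne eq with u ≟ w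
  ... | yes refl = ne refl
  ... | no _     = <⇒≢ (col<k t (vert u)) (trans (sym eq) new-w)
  fresh : ∀ x ys z → w ∉ ys → All (_≢ vert w) (items x ys z)
  fresh x []       z _  = (λ ()) ∷ []
  fresh x (y ∷ ys) z w∉ = (λ ()) ∷ (λ { refl → w∉ (here refl) }) ∷ fresh y ys z (w∉ ∘ there)
  sat : Saturated G c⁺ S w
  sat {u} u∈ u≢w = refine p , AllP.map⁺ (All.map k≢ (fresh w (mid p) u (u∉mid p)))
    where p = path t w∈ u∈ (u≢w ∘ sym)

-- Every edge at v gets the fresh colour k, and v an old one, that of w. Paths from v run through w,
-- whose colour is absent from its own paths; and w stays saturated, since it reaches v by a single
-- edge of colour k.
attach : {G : Graph n} {S : List (Fin n)} {w : Fin n} (v : Fin n) → w ∈ S → adj G w v ≡ true →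
         SatColourable G k S w → SatColourable G (suc k) (v ∷ S) w
attach {n} {k} {G} {S} {w} v w∈ wv (c , t , sat) with v VMem.∈? S
-- A vertex already present keeps its colours, so that no disjointness has to be assumed in
-- `attachAll`.
... | yes v∈ = c , Connecting-resp there sub (proj₂ (Colourable-≤ (n≤1+n k) (c , t))) ,
      λ u∈ ne → let p , q = sat (sub u∈) ne in recolourPath there p refl , q
  where
  sub : v ∷ S ⊆ S
  sub (here refl) = v∈
  sub (there q)   = q
... | no v∉S = c⁺ , t⁺ , sat⁺
  where
  γ = col c (vert w)
  f : Fin n → ℕ
  f _ = k
  c⁺ = addVertex c v γ f
  ≢v : ∀ {x} → x ∈ S → x ≢ v
  ≢v x∈ refl = v∉S x∈
  cw : col c⁺ (vert w) ≡ col c (vert w)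
  cw = addVertex-old-vert c v γ f (≢v w∈)
  cvw : col c⁺ (edge v w) ≡ k
  cvw = addVertex-edge c v γ f w
  k≢ : ∀ i → k ≢ col c i
  k≢ i = ≢-sym (<⇒≢ (col<k t i))
  old : ∀ {u} → u ∈ S → u ≢ w → Σ (RainbowPath G (col c⁺) (v ∷ S) w u) λ p →
        v ∉ mid p × All (col c⁺ (edge v w) ≢_) (map (col c⁺) (items w (mid p) u)) ×
        All (col c⁺ (vert w) ≢_) (map (col c⁺) (items w (mid p) u))
  old {u} u∈ u≢w with p , q ← sat u∈ u≢w =
    addVertex-old-path c v γ f v∉S w∈ u∈ p ,
    (λ v∈ → v∉S (All.lookup (mid∈S p) v∈)) ,
    subst₂ (λ x l → All (x ≢_) l) (sym cvw) (sym eq) (AllP.map⁺ (All.tabulate (λ {i} _ → k≢ i))) ,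
    subst₂ (λ x l → All (x ≢_) l) (sym cw) (sym eq) q
    where eq = addVertex-old-items c v γ f v∉S w∈ (mid∈S p) u∈
  cw≢ : col c⁺ (edge v w) ≢ col c⁺ (vert w)
  cw≢ eq = k≢ (vert w) (trans (sym cvw) (trans eq cw))
  vw : adj G v w ≡ true
  vw = trans (adjSym G v w) wv
  vpath : ∀ {u} → u ∈ S → RainbowPath G (col c⁺) (v ∷ S) v u
  vpath {u} u∈ with u ≟ w
  ... | yes refl = directPath vw
  ... | no u≢w with p , v∉ , e≢ , w≢ ← old u∈ u≢w =
    consPath vw p (≢v w∈ ∘ sym) u≢w v∉ (there w∈) (cw≢ ∷ e≢) w≢
  t⁺ : Connecting G c⁺ (suc k) (v ∷ S)
  t⁺ = addVertex-connecting c v γ f v∉S (n≤1+n k) (m<n⇒m<1+n (col<k t (vert w))) (λ _ → n<1+n k)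
         (λ {z} _ _ → k≢ (vert w) , k≢ (vert z)) vpath t
  sat⁺ : Saturated G c⁺ (v ∷ S) w
  sat⁺ (here refl) _  = directPath wv ,
    (λ eq → cw≢ (sym (trans eq (colSym c⁺ w v)))) ∷ []
  sat⁺ (there u∈) ne = let p , _ , _ , w≢ = old u∈ ne in p , w≢

attachAll : {G : Graph n} {S : List (Fin n)} {w : Fin n} (L : List (Fin n)) → w ∈ S →
            All (λ v → adj G w v ≡ true) L →
            SatColourable G k S w → SatColourable G (length L + k) (L ++ S) w
attachAll []      _  _        s = s
attachAll (v ∷ L) w∈ (e ∷ es) s = attach v (∈-++⁺ʳ L w∈) e (attachAll L w∈ es s)

Sat⇒Colourable : {G : Graph n} {S : List (Fin n)} {w : Fin n} → SatColourable G k S w → Colourable G k S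
Sat⇒Colourable (c , t , _) = c , t

add-pendant : {G : Graph n} {S : List (Fin n)} {w : Fin n} (v : Fin n) → w ∈ S → adj G w v ≡ true →
              Colourable G k S → Colourable G (2 + k) (v ∷ S)
add-pendant v w∈ e s = Sat⇒Colourable (attach v w∈ e (saturate _ w∈ s))

-- Exhaustive search over functions

-- Functions on a finite set can be enumerated only up to pointwise equality; hence the relation
-- that the predicate must respect.
Searchable : (A : Set) → (A → A → Set) → Set₁
Searchable A _≈_ = (P : A → Set) → (∀ {a b} → a ≈ b → P a → P b) → Decidable P → Dec (∃ P)

search-Fin : Searchable (Fin k) _≡_
search-Fin P _ P? = FinP.any? P?

search-Bool : Searchable Bool _≡_
search-Bool P _ P? with P? true | P? false
... | yes p | _     = yes (true , p)
... | no _  | yes p = yes (false , p)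
... | no ¬t | no ¬f = no λ { (true , p) → ¬t p ; (false , p) → ¬f p }

search-fun : {A : Set} {_≈_ : A → A → Set} → (∀ {a} → a ≈ a) →
             Searchable A _≈_ → Searchable (Fin m → A) (λ f g → ∀ i → f i ≈ g i)
search-fun {zero} refl≈ s P resp P? = map′ (_ ,_) (λ (f , p) → resp (λ ()) p) (P? (λ ()))
search-fun {suc m} {A} {_≈_} refl≈ s P resp P? =
  map′ (λ (a , g , p) → cons a g , p)
       (λ (f , p) → f zero , f ∘ suc , resp (λ { zero → refl≈ ; (suc i) → refl≈ }) p)
       (s (λ a → ∃ λ g → P (cons a g))
          (λ a≈b (g , p) → g , resp (λ { zero → a≈b ; (suc i) → refl≈ }) p)
          (λ a → search-fun refl≈ s (P ∘ cons a) (λ g≈h → resp (λ { zero → refl≈ ; (suc i) → g≈h i })) (P? ∘ cons a)))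
  where
  cons : A → (Fin m → A) → Fin (suc m) → A
  cons a g zero    = a
  cons a g (suc i) = g i

-- Complementary graphs and connectivity by cuts

-- A symmetric relation in place of the operation `complement`, so that the two graphs can exchange
-- roles in every argument.
record Complementary (G H : Graph n) : Set where
  field opposite : ∀ {u w} → u ≢ w → adj H u w ≡ not (adj G u w)
open Complementary public

complementary-sym : {G H : Graph n} → Complementary G H → Complementary H G
complementary-sym {G = G} comp .opposite {u} {w} u≢w =
  trans (sym (not-involutive (adj G u w))) (cong not (sym (opposite comp u≢w)))

adj⇒≢ : (G : Graph n) {u w : Fin n} → adj G u w ≡ true → u ≢ w
adj⇒≢ G {u} e refl with () ← trans (sym e) (adjIrrefl G u)

true≢false : {b : Bool} → b ≡ true → b ≡ false → ⊥
true≢false refl ()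

adj-swap : (G : Graph n) {u w : Fin n} {b : Bool} → adj G u w ≡ b → adj G w u ≡ b
adj-swap G {u} {w} e = trans (adjSym G w u) e

co-true : {G H : Graph n} → Complementary G H → ∀ {u w} → u ≢ w → adj G u w ≡ false → adj H u w ≡ true
co-true comp u≢w e = trans (opposite comp u≢w) (cong not e)

co-false : {G H : Graph n} → Complementary G H → ∀ {u w} → adj G u w ≡ true → adj H u w ≡ false
co-false {G = G} comp e = trans (opposite comp (adj⇒≢ G e)) (cong not e)

-- Connectivity of the subgraph induced on S, with a map to `Bool` as a bipartition. This form
-- depends only on the members of S, is decidable by search, and its failure is exactly the split
-- needed to find an induced P₄.
record CutConnected (G : Graph n) (S : List (Fin n)) : Set where
  field cut : (f : Fin n → Bool) → ∀ {u w} → u ∈ S → w ∈ S → f u ≢ f w →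
              ∃₂ λ x y → x ∈ S × y ∈ S × f x ≢ f y × adj G x y ≡ true
open CutConnected public

Split : Graph n → List (Fin n) → Set
Split {n} G S = Σ (Fin n → Bool) λ f →
  (∃₂ λ u w → u ∈ S × w ∈ S × f u ≢ f w) × (∀ {x y} → x ∈ S → y ∈ S → f x ≢ f y → adj G x y ≡ false)

cutConnected⊎split : (G : Graph n) (S : List (Fin n)) → CutConnected G S ⊎ Split G S
cutConnected⊎split {n} G S with search-fun refl search-Bool P P-resp P?
  where
  P : (Fin n → Bool) → Set
  P f = Any (λ u → Any (λ w → f u ≢ f w) S) S × All (λ x → All (λ y → f x ≡ f y ⊎ adj G x y ≡ false) S) S
  P-resp : ∀ {f g} → (∀ i → f i ≡ g i) → P f → P g
  P-resp eq (any , all) =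
    Any.map (λ {u} → Any.map (λ {w} ne q → ne (trans (eq u) (trans q (sym (eq w)))))) any ,
    All.map (λ {x} → All.map λ { {y} (inj₁ q) → inj₁ (trans (sym (eq x)) (trans q (eq y))) ; (inj₂ q) → inj₂ q }) all
  P? : Decidable P
  P? f = Any.any? (λ u → Any.any? (λ w → ¬? (f u Bool.≟ f w)) S) S ×-dec
         All.all? (λ x → All.all? (λ y → (f x Bool.≟ f y) ⊎-dec (adj G x y Bool.≟ false)) S) S
... | yes (f , any , all) with u , u∈ , any′ ← find any with w , w∈ , ne ← find any′ =
  inj₂ (f , (u , w , u∈ , w∈ , ne) , λ x∈ y∈ ne′ → pick ne′ (All.lookup (All.lookup all x∈) y∈))
  where
  pick : ∀ {x y} → f x ≢ f y → f x ≡ f y ⊎ adj G x y ≡ false → adj G x y ≡ false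
  pick ne (inj₁ q) = ⊥-elim (ne q)
  pick ne (inj₂ q) = q
... | no none = inj₁ conn
  where
  conn : CutConnected G S
  conn .cut f u∈ w∈ ne
    with Any.any? (λ x → Any.any? (λ y → ¬? (f x Bool.≟ f y) ×-dec (adj G x y Bool.≟ true)) S) S
  ... | yes any with x , x∈ , any′ ← find any with y , y∈ , ne′ , e ← find any′ = x , y , x∈ , y∈ , ne′ , e
  ... | no ¬any = ⊥-elim (none (f , lose u∈ (lose w∈ ne) , All.tabulate λ x∈ → All.tabulate λ y∈ → uncut x∈ y∈))
    where
    uncut : ∀ {x y} → x ∈ S → y ∈ S → f x ≡ f y ⊎ adj G x y ≡ false
    uncut {x} {y} x∈ y∈ with f x Bool.≟ f y | adj G x y in e
    ... | yes q | _     = inj₁ q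
    ... | no _  | false = inj₂ refl
    ... | no q  | true  = ⊥-elim (¬any (lose x∈ (lose y∈ (q , e))))

crossing : {G : Graph n} {S : List (Fin n)} → CutConnected G S → {P : Fin n → Set} → Decidable P →
           ∀ {u w} → u ∈ S → P u → w ∈ S → ¬ P w → ∃₂ λ x y → x ∈ S × y ∈ S × P x × ¬ P y × adj G x y ≡ true
crossing {n} {G} {S} conn {P} P? {u} {w} u∈ pu w∈ ¬pw
  with cut conn (does ∘ P?) u∈ w∈ differ
  where
  differ : does (P? u) ≢ does (P? w)
  differ with P? u | P? w
  ... | yes _ | no _  = λ ()
  ... | no ¬p | _     = ⊥-elim (¬p pu)
  ... | yes _ | yes p = ⊥-elim (¬pw p)
... | x , y , x∈ , y∈ , ne , e with P? x | P? y
... | yes px | no ¬py = x , y , x∈ , y∈ , px , ¬py , e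
... | no ¬px | yes py = y , x , y∈ , x∈ , py , ¬px , adj-swap G e
... | yes _  | yes _  = ⊥-elim (ne refl)
... | no _   | no _   = ⊥-elim (ne refl)

cutConnected-resp : {G : Graph n} {S S′ : List (Fin n)} → S ↭ S′ → CutConnected G S → CutConnected G S′
cutConnected-resp p conn .cut f u∈ w∈ ne
  with x , y , x∈ , y∈ , r ← cut conn f (∈-resp-↭ (↭-sym p) u∈) (∈-resp-↭ (↭-sym p) w∈) ne =
  x , y , ∈-resp-↭ p x∈ , ∈-resp-↭ p y∈ , r

cutConnected-∷ : {G : Graph n} {S : List (Fin n)} {v w : Fin n} → w ∈ S → adj G v w ≡ true →
                 CutConnected G S → CutConnected G (v ∷ S)
cutConnected-∷ {G = G} {S} {v} {w} w∈ vw conn .cut f {x} {y} x∈ y∈ ne with f v Bool.≟ f w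
... | no q = v , w , here refl , there w∈ , q , vw
... | yes q with move x∈ | move y∈
  where
  move : ∀ {x} → x ∈ v ∷ S → ∃ λ x′ → x′ ∈ S × f x′ ≡ f x
  move (here refl) = w , w∈ , sym q
  move (there x∈)  = _ , x∈ , refl
... | x′ , x′∈ , ex | y′ , y′∈ , ey
  with a , b , a∈ , b∈ , r ← cut conn f x′∈ y′∈ (λ eq → ne (trans (sym ex) (trans eq ey))) =
  a , b , there a∈ , there b∈ , r

neighbour : {G : Graph n} {T : List (Fin n)} {v u : Fin n} → v ∉ T → u ∈ T → CutConnected G (v ∷ T) →
            ∃ λ w → w ∈ T × adj G v w ≡ true
neighbour {v = v} v∉ u∈ conn
  with crossing conn (_≟ v) (here refl) refl (there u∈) (λ { refl → v∉ u∈ })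
... | _ , y , _ , here refl , refl , ¬p , _ = ⊥-elim (¬p refl)
... | _ , y , _ , there y∈ , refl , _ , e = y , y∈ , e

-- Induced paths on four vertices

record InducedP₄ (G : Graph n) (S : List (Fin n)) : Set where
  field
    {a b c d} : Fin n
    a∈ : a ∈ S
    b∈ : b ∈ S
    c∈ : c ∈ S
    d∈ : d ∈ S
    ab : adj G a b ≡ true
    bc : adj G b c ≡ true
    cd : adj G c d ≡ true
    ac : adj G a c ≡ false
    ad : adj G a d ≡ false
    bd : adj G b d ≡ false

  a≢b : a ≢ b
  a≢b = adj⇒≢ G ab
  b≢c : b ≢ c
  b≢c = adj⇒≢ G bc
  c≢d : c ≢ d
  c≢d = adj⇒≢ G cd
  a≢c : a ≢ c
  a≢c eq = true≢false cd (subst (λ x → adj G x d ≡ false) eq ad)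
  a≢d : a ≢ d
  a≢d eq = true≢false (adj-swap G ab) (subst (λ x → adj G b x ≡ false) (sym eq) bd)
  b≢d : b ≢ d
  b≢d eq = true≢false ab (subst (λ x → adj G a x ≡ false) (sym eq) ad)

  vertices : List (Fin n)
  vertices = a ∷ b ∷ c ∷ d ∷ []

  vertices-unique : Unique vertices
  vertices-unique = (a≢b ∷ a≢c ∷ a≢d ∷ []) ∷ (b≢c ∷ b≢d ∷ []) ∷ (c≢d ∷ []) ∷ [] ∷ []

  vertices⊆ : vertices ⊆ S
  vertices⊆ (here refl) = a∈
  vertices⊆ (there (here refl)) = b∈
  vertices⊆ (there (there (here refl))) = c∈
  vertices⊆ (there (there (there (here refl)))) = d∈

P₄-complement : {G H : Graph n} {S : List (Fin n)} → Complementary G H → InducedP₄ G S → InducedP₄ H S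
P₄-complement {G = G} {H} comp p = record
  { a∈ = b∈ ; b∈ = d∈ ; c∈ = a∈ ; d∈ = c∈
  ; ab = co-true comp b≢d bd
  ; bc = adj-swap H (co-true comp a≢d ad)
  ; cd = co-true comp a≢c ac
  ; ac = adj-swap H (co-false comp ab)
  ; ad = co-false comp bc
  ; bd = adj-swap H (co-false comp cd)
  }
  where open InducedP₄ p

P₄-⊆ : {G : Graph n} {S S′ : List (Fin n)} → S ⊆ S′ → InducedP₄ G S → InducedP₄ G S′
P₄-⊆ S⊆ p = record { InducedP₄ p hiding (a∈; b∈; c∈; d∈)
                   ; a∈ = S⊆ (InducedP₄.a∈ p) ; b∈ = S⊆ (InducedP₄.b∈ p)
                   ; c∈ = S⊆ (InducedP₄.c∈ p) ; d∈ = S⊆ (InducedP₄.d∈ p) }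

-- If G − x falls apart, take a non-neighbour z of x: on the side of z some edge joins a
-- neighbour p of x to a non-neighbour q, and the other side contains a neighbour r.
split⇒P₄ : {G : Graph n} {S : List (Fin n)} {x z : Fin n} → x ∉ S → z ∈ S → adj G x z ≡ false →
           CutConnected G (x ∷ S) → Split G S → InducedP₄ G (x ∷ S)
split⇒P₄ {n} {G} {S} {x} {z} x∉ z∈ xz conn (f , (u , w , u∈ , w∈ , ne) , uncut) =
  assemble R QP
  where
  ≢x : ∀ {v} → v ∈ S → v ≢ x
  ≢x v∈ refl = x∉ v∈
  in-S : ∀ {v} → v ∈ x ∷ S → v ≢ x → v ∈ S
  in-S (here refl) ne = ⊥-elim (ne refl)
  in-S (there v∈)  _  = v∈
  other : ∃ λ v → v ∈ S × f v ≢ f z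
  other with f u Bool.≟ f z
  ... | no q  = u , u∈ , q
  ... | yes q = w , w∈ , λ eq → ne (trans q (sym eq))
  Other-side = ∃ λ r → r ∈ S × f r ≢ f z × adj G r x ≡ true
  R : Other-side
  R with v , v∈ , fv ← other
    with crossing conn (λ v → ¬? (v ≟ x) ×-dec ¬? (f v Bool.≟ f z)) (there v∈) (≢x v∈ , fv) (here refl) (λ (p , _) → p refl)
  ... | r , t , r∈ , t∈ , (r≢x , fr) , ¬t , e with t ≟ x
  ... | yes refl = r , in-S r∈ r≢x , fr , e
  ... | no t≢x with f t Bool.≟ f z
  ... | yes ft = ⊥-elim (true≢false e (uncut (in-S r∈ r≢x) (in-S t∈ t≢x) (λ eq → fr (trans eq ft))))
  ... | no ft  = ⊥-elim (¬t (t≢x , ft))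
  Same-side = ∃₂ λ q p → q ∈ S × p ∈ S × f q ≡ f z × f p ≡ f z × adj G x q ≡ false × adj G x p ≡ true × adj G q p ≡ true
  QP : Same-side
  QP with crossing conn (λ v → ¬? (v ≟ x) ×-dec (f v Bool.≟ f z) ×-dec (adj G x v Bool.≟ false))
            (there z∈) (≢x z∈ , refl , xz) (here refl) (λ (p , _) → p refl)
  ... | q , p , q∈ , p∈ , (q≢x , fq , xq) , ¬p , e with p ≟ x
  ... | yes refl = ⊥-elim (true≢false (adj-swap G e) xq)
  ... | no p≢x with f p Bool.≟ f z
  ... | no fp = ⊥-elim (true≢false e (uncut (in-S q∈ q≢x) (in-S p∈ p≢x) (λ eq → fp (trans (sym eq) fq))))
  ... | yes fp with adj G x p in xp
  ... | true  = q , p , in-S q∈ q≢x , in-S p∈ p≢x , fq , fp , xq , xp , e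
  ... | false = ⊥-elim (¬p (p≢x , fp , refl))
  assemble : Other-side → Same-side → InducedP₄ G (x ∷ S)
  assemble (r , r∈ , fr , rx) (q , p , q∈ , p∈ , fq , fp , xq , xp , qp) = record
    { a∈ = there r∈ ; b∈ = here refl ; c∈ = there p∈ ; d∈ = there q∈
    ; ab = rx ; bc = xp ; cd = adj-swap G qp
    ; ac = uncut r∈ p∈ (λ eq → fr (trans eq fp)) ; ad = uncut r∈ q∈ (λ eq → fr (trans eq fq)) ; bd = xq }

abstract
  -- Delete x. If one of the graphs falls apart, `split⇒P₄` finds the path there, and P₄ is
  -- self-complementary; if neither does, recursion applies. It cannot reach two vertices, as these
  -- are adjacent in only one of the graphs.
  inducedP₄ : {G H : Graph n} → Complementary G H → (S : List (Fin n)) → Unique S → 2 ≤ length S →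
              CutConnected G S → CutConnected H S → InducedP₄ G S
  inducedP₄ {G = G} {H} comp (x ∷ []) _ (s≤s ()) _ _
  inducedP₄ {G = G} {H} comp (x ∷ y ∷ []) u _ connG connH
    with _ , here refl , xy ← neighbour (Unique[x∷xs]⇒x∉xs u) (here refl) connG
       | _ , here refl , xy′ ← neighbour (Unique[x∷xs]⇒x∉xs u) (here refl) connH =
    ⊥-elim (true≢false xy′ (co-false comp xy))
  inducedP₄ {G = G} {H} comp (x ∷ S@(_ ∷ _ ∷ _)) u@(_ ∷ uS) _ connG connH
    with z , z∈ , xz ← neighbour (Unique[x∷xs]⇒x∉xs u) (here refl) connG
       | w , w∈ , xw ← neighbour (Unique[x∷xs]⇒x∉xs u) (here refl) connH
    with cutConnected⊎split G S | cutConnected⊎split H S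
  ... | inj₂ s | _ = split⇒P₄ (Unique[x∷xs]⇒x∉xs u) w∈
          (co-false (complementary-sym comp) xw) connG s
  ... | inj₁ _ | inj₂ s = P₄-complement (complementary-sym comp)
          (split⇒P₄ (Unique[x∷xs]⇒x∉xs u) z∈ (co-false comp xz) connH s)
  ... | inj₁ cG | inj₁ cH = P₄-⊆ there (inducedP₄ comp S uS (s≤s (s≤s z≤n)) cG cH)

-- Removing a vertex while both graphs stay connected

-- When T is a module containing s, the set without s has the same quotient.
module-removal : {G : Graph n} {s t₀ : Fin n} {T R : List (Fin n)} → s ∉ T ++ R → (∀ {v} → v ∈ R → v ∉ T) → t₀ ∈ T →
  (∃ λ r → r ∈ R) →
  (∀ {v t t′} → v ∈ R → t ∈ s ∷ T → t′ ∈ s ∷ T → adj G v t ≡ adj G v t′) →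
  CutConnected G (s ∷ T ++ R) → CutConnected G (T ++ R)
module-removal {n} {G} {s} {t₀} {T} {R} s∉ R∉ t₀∈ (r₀ , r₀∈) hom conn .cut f {u} {w} u∈ w∈ ne
  with crossing conn (VMem._∈? (s ∷ T)) (here refl) (here refl) (there (∈-++⁺ʳ T r₀∈)) r₀∉
  where
  r₀∉ : r₀ ∉ s ∷ T
  r₀∉ (here refl) = s∉ (∈-++⁺ʳ T r₀∈)
  r₀∉ (there q)   = R∉ r₀∈ q
... | t , r , _ , r∈′ , t∈ , r∉ , e with in-R r∈′ r∉
  where
  in-R : ∀ {v} → v ∈ s ∷ T ++ R → v ∉ s ∷ T → v ∈ R
  in-R (here refl) v∉ = ⊥-elim (v∉ (here refl))
  in-R (there q)   v∉ with ∈-++⁻ T q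
  ... | inj₁ q′ = ⊥-elim (v∉ (there q′))
  ... | inj₂ q′ = q′
... | r∈ with Any.any? (λ t → ¬? (f t Bool.≟ f r)) T
... | yes any with t′ , t′∈ , ft ← find any =
  t′ , r , ∈-++⁺ˡ t′∈ , ∈-++⁺ʳ T r∈ , ft , adj-swap G (trans (hom r∈ (there t′∈) t∈) (adj-swap G e))
-- Here `f` has the value `f r` on all of T. Giving s the same value makes any crossing edge at s
-- end in R, and such an edge can be moved from s to `t₀`.
... | no ¬any = result
  where
  const : ∀ {t} → t ∈ T → f t ≡ f r
  const {t} t∈ = decidable-stable (f t Bool.≟ f r) (λ q → ¬any (lose t∈ q))
  f′′ : (x : Fin n) → Dec (x ≡ s) → Bool
  f′′ x (yes _) = f r
  f′′ x (no _)  = f x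
  f′ : Fin n → Bool
  f′ x = f′′ x (x ≟ s)
  f′-old : ∀ {x} → x ∈ T ++ R → f′ x ≡ f x
  f′-old {x} x∈ with x ≟ s
  ... | yes refl = ⊥-elim (s∉ x∈)
  ... | no _     = refl
  f′-s : f′ s ≡ f r
  f′-s with s ≟ s
  ... | yes _ = refl
  ... | no ¬p = ⊥-elim (¬p refl)
  Crossing = ∃₂ λ x y → x ∈ T ++ R × y ∈ T ++ R × f x ≢ f y × adj G x y ≡ true
  at-s : ∀ {y} → y ∈ T ++ R → f y ≢ f r → adj G s y ≡ true → Crossing
  at-s {y} y∈ fy sy with ∈-++⁻ T y∈
  ... | inj₁ y∈T = ⊥-elim (fy (const y∈T))
  ... | inj₂ y∈R = t₀ , y , ∈-++⁺ˡ t₀∈ , y∈ , (λ eq → fy (trans (sym eq) (const t₀∈))) ,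
                   adj-swap G (trans (hom y∈R (there t₀∈) (here refl)) (adj-swap G sy))
  result : Crossing
  result with cut conn f′ (there u∈) (there w∈) (λ eq → ne (trans (sym (f′-old u∈)) (trans eq (f′-old w∈))))
  ... | x , y , here refl , here refl , q , _ = ⊥-elim (q refl)
  ... | x , y , here refl , there y∈ , q , xy = at-s y∈ (λ eq → q (trans f′-s (trans (sym eq) (sym (f′-old y∈))))) xy
  ... | x , y , there x∈ , here refl , q , xy = at-s x∈ (λ eq → q (trans (f′-old x∈) (trans eq (sym f′-s)))) (adj-swap G xy)
  ... | x , y , there x∈ , there y∈ , q , xy =
    x , y , x∈ , y∈ , (λ eq → q (trans (f′-old x∈) (trans eq (sym (f′-old y∈))))) , xy

Removable : Graph n → Graph n → List (Fin n) → Set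
Removable G H S = ∃₂ λ v T → S ↭ v ∷ T × CutConnected G T × CutConnected H T

unique-++-disjoint : (T R : List (Fin n)) → Unique (T ++ R) → ∀ {v} → v ∈ R → v ∉ T
unique-++-disjoint (t ∷ T) R u@(_ ∷ u′) v∈R (here refl) = Unique[x∷xs]⇒x∉xs u (∈-++⁺ʳ T v∈R)
unique-++-disjoint (t ∷ T) R (_ ∷ u′)   v∈R (there v∈T) = unique-++-disjoint T R u′ v∈R v∈T

nonempty : (R : List (Fin n)) → length R ≡ suc m → ∃ λ r → r ∈ R
nonempty (r ∷ _) _ = r , here refl

-- T absorbs an outside vertex as long as one has neighbours in T in both graphs; the last vertex
-- outside is removable. If T gets stuck, each vertex of R is joined to all or none of T, and a
-- vertex s of the module T is removable: T has a second vertex to replace s in every connection.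
grow-to-removable : {G H : Graph n} → Complementary G H → (m : ℕ) (T R : List (Fin n)) → length R ≡ suc m →
  2 ≤ length T → Unique (T ++ R) → CutConnected G T → CutConnected H T →
  CutConnected G (T ++ R) → CutConnected H (T ++ R) → Removable G H (T ++ R)
grow-to-removable comp zero T (v ∷ []) _ _ u cG cH _ _ = v , T , Perm.++-comm T [ v ] , cG , cH
grow-to-removable {G = G} {H} comp (suc m) T R len lenT u cG cH cG⁺ cH⁺
  with Any.any? (λ v → Any.any? (λ t → adj G v t Bool.≟ true) T ×-dec Any.any? (λ t → adj H v t Bool.≟ true) T) R
... | yes any with v , v∈ , nG , nH ← find any
    with t , t∈ , vt ← find nG | t′ , t′∈ , vt′ ← find nH
    with R′ , p ← ∈⇒↭ v∈ =
    let q = ↭-trans (Perm.++⁺ˡ T p) (shift v T R′)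
        x , U , p′ , r = grow-to-removable comp m (v ∷ T) R′ (suc-injective (trans (sym (↭-length p)) len))
                 (m≤n⇒m≤1+n lenT) (Unique-resp-↭ q u)
                 (cutConnected-∷ t∈ vt cG) (cutConnected-∷ t′∈ vt′ cH)
                 (cutConnected-resp q cG⁺) (cutConnected-resp q cH⁺)
    in x , U , ↭-trans q p′ , r
grow-to-removable comp (suc m) (_ ∷ []) R len (s≤s ()) u cG cH cG⁺ cH⁺ | no ¬any
grow-to-removable {n} {G} {H} comp (suc m) (s ∷ T@(t₀ ∷ _)) R len lenT u@(_ ∷ u′) cG cH cG⁺ cH⁺ | no ¬any =
  s , T ++ R , ↭-refl ,
  module-removal s∉ R∉T (here refl) r₀ homG cG⁺ , module-removal s∉ R∉T (here refl) r₀ homH cH⁺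
  where
  s∉ = Unique[x∷xs]⇒x∉xs u
  R∉T : ∀ {v} → v ∈ R → v ∉ T
  R∉T = unique-++-disjoint T R u′
  R∉ : ∀ {v} → v ∈ R → v ∉ s ∷ T
  R∉ = unique-++-disjoint (s ∷ T) R u
  ≢R : ∀ {v t} → v ∈ R → t ∈ s ∷ T → v ≢ t
  ≢R v∈ t∈ refl = R∉ v∈ t∈
  r₀ : ∃ λ r → r ∈ R
  r₀ = nonempty R len
  homG : ∀ {v t t′} → v ∈ R → t ∈ s ∷ T → t′ ∈ s ∷ T → adj G v t ≡ adj G v t′
  homG {v} {t} {t′} v∈ t∈ t′∈ with adj G v t in e | adj G v t′ in e′
  ... | true  | true  = refl
  ... | false | false = refl
  ... | true  | false = ⊥-elim (¬any (lose v∈ (lose t∈ e , lose t′∈ (co-true comp (≢R v∈ t′∈) e′))))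
  ... | false | true  = ⊥-elim (¬any (lose v∈ (lose t′∈ e′ , lose t∈ (co-true comp (≢R v∈ t∈) e))))
  homH : ∀ {v t t′} → v ∈ R → t ∈ s ∷ T → t′ ∈ s ∷ T → adj H v t ≡ adj H v t′
  homH v∈ t∈ t′∈ = trans (opposite comp (≢R v∈ t∈)) (trans (cong not (homG v∈ t∈ t′∈)) (sym (opposite comp (≢R v∈ t′∈))))

⊆⇒↭++ : (T : List (Fin n)) {S : List (Fin n)} → Unique T → T ⊆ S → ∃ λ R → S ↭ T ++ R
⊆⇒↭++ []      {S} _ _ = S , ↭-refl
⊆⇒↭++ (t ∷ T) {S} u@(_ ∷ uT) T⊆ with S′ , p ← ∈⇒↭ (T⊆ (here refl)) =
  let R , q = ⊆⇒↭++ T uT sub in R , ↭-trans p (↭-prep t q)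
  where
  sub : T ⊆ S′
  sub x∈ with ∈-resp-↭ p (T⊆ (there x∈))
  ... | here refl = ⊥-elim (Unique[x∷xs]⇒x∉xs u x∈)
  ... | there q   = q

cutConnected-singleton : {G : Graph n} (d : Fin n) → CutConnected G (d ∷ [])
cutConnected-singleton d .cut f (here refl) (here refl) ne = ⊥-elim (ne refl)

P₄-cutConnected : {G : Graph n} {S : List (Fin n)} (p : InducedP₄ G S) → CutConnected G (InducedP₄.vertices p)
P₄-cutConnected {G = G} p = cutConnected-∷ (here refl) ab (cutConnected-∷ (here refl) bc
  (cutConnected-∷ (here refl) cd (cutConnected-singleton d)))
  where open InducedP₄ p

P₄-complement-vertices : {G H : Graph n} {S : List (Fin n)} (comp : Complementary G H) (p : InducedP₄ G S) →
                         InducedP₄.vertices (P₄-complement comp p) ↭ InducedP₄.vertices p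
P₄-complement-vertices _ p =
  ↭-trans (↭-prep b (↭-trans (↭-swap d a ↭-refl) (↭-prep a (↭-swap d c ↭-refl)))) (↭-swap b a ↭-refl)
  where open InducedP₄ p

abstract
  -- An induced P₄ starts the growth, being connected in both graphs; the fifth vertex ensures that
  -- something lies outside it.
  removable : {G H : Graph n} → Complementary G H → (S : List (Fin n)) → Unique S → 5 ≤ length S →
              CutConnected G S → CutConnected H S → Removable G H S
  removable {n} {G} {H} comp S u 5≤ cG cH = go (⊆⇒↭++ vertices vertices-unique vertices⊆)
    where
    p : InducedP₄ G S
    p = inducedP₄ comp S u (≤-trans (s≤s (s≤s z≤n)) 5≤) cG cH
    open InducedP₄ p using (vertices; vertices-unique; vertices⊆)
    go : (∃ λ R → S ↭ vertices ++ R) → Removable G H S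
    go ([] , S↭) = ⊥-elim (<-irrefl refl (subst (5 ≤_) (↭-length S↭) 5≤))
    go (R@(_ ∷ _) , S↭) =
      let x , U , r , cGU , cHU = grow-to-removable comp _ vertices R refl (s≤s (s≤s z≤n))
            (Unique-resp-↭ S↭ u) (P₄-cutConnected p)
            (cutConnected-resp (P₄-complement-vertices comp p) (P₄-cutConnected (P₄-complement comp p)))
            (cutConnected-resp S↭ cG) (cutConnected-resp S↭ cH)
      in x , U , ↭-trans S↭ r , cGU , cHU

-- Adding vertices to a colouring

-- R is added along a spanning tree grown from T, each vertex at the price of two colours: one for
-- its edge, one for the vertex at which it is attached.
spanning-growth : {G : Graph n} (m : ℕ) (T R : List (Fin n)) {t : Fin n} → length R ≡ m → t ∈ T → Unique (T ++ R) →
                  CutConnected G (T ++ R) → Colourable G k T → Colourable G (2 * m + k) (T ++ R)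
spanning-growth zero T [] _ _ _ _ s = Colourable-↭ (↭-sym (Perm.++-identityʳ T)) s
spanning-growth {n} {k} {G} (suc m) T R len t∈ u conn s
  with r₀ , r₀∈ ← nonempty R len
  with x , y , _ , y∈ , x∈T , y∉T , xy ← crossing conn (VMem._∈? T) (∈-++⁺ˡ t∈) t∈ (∈-++⁺ʳ T r₀∈) (unique-++-disjoint T R u r₀∈)
  with ∈-++⁻ T y∈
... | inj₁ y∈T = ⊥-elim (y∉T y∈T)
... | inj₂ y∈R with R′ , p ← ∈⇒↭ y∈R =
  subst (λ k → Colourable G k (T ++ R)) eq (Colourable-↭ (↭-sym q)
    (spanning-growth m (y ∷ T) R′ (suc-injective (trans (sym (↭-length p)) len)) (there t∈) (Unique-resp-↭ q u)
      (cutConnected-resp q conn) (add-pendant y x∈T xy s)))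
  where
  q = ↭-trans (Perm.++⁺ˡ T p) (shift y T R′)
  open +-*-Solver
  eq : 2 * m + (2 + k) ≡ 2 * suc m + k
  eq = solve 2 (λ m k → con 2 :* m :+ (con 2 :+ k) := con 2 :* (con 1 :+ m) :+ k) refl m k

module _ {G : Graph n} {c : Colouring n} {S : List (Fin n)} (t : Connecting G c k S) {v : Fin n} (v∉S : v ∉ S) where

  private
    C = col c

  -- The vertex v gets colour 0, and each edge vz avoids 0, the colour of z and the colours of the
  -- edges from z into M: 2 + |M| colours, one fewer than the required supply.
  add-vertex-radius-two : (M : List (Fin n)) → 3 + length M ≤ k →
    (∀ {u} → u ∈ S → adj G v u ≡ true ⊎ u ∈ M × ∃ λ w → w ∈ S × adj G v w ≡ true × adj G w u ≡ true) →
    Colourable G k (v ∷ S)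
  add-vertex-radius-two M M< reach = addVertex-two-step v 0 f t v∉S (≤-trans (s≤s z≤n) M<) (proj₁ ∘ proj₂ ∘ fresh)
    (λ {z} _ → (f∉ z ∘ here) , (f∉ z ∘ there ∘ here))
    λ {u} u∈ → reach′ (reach u∈)
    where
    avoid : Fin n → List ℕ
    avoid z = 0 ∷ C (vert z) ∷ map (λ u → C (edge z u)) M
    fresh : ∀ z → ∃ λ c → c < k × c ∉ avoid z
    fresh z = freshColour (avoid z) (subst (λ l → 3 + l ≤ k) (sym (length-map _ M)) M<)
    f = proj₁ ∘ fresh
    f∉ : ∀ z → f z ∉ avoid z
    f∉ z = proj₂ (proj₂ (fresh z))
    reach′ : ∀ {u} → adj G v u ≡ true ⊎ u ∈ M × (∃ λ w → w ∈ S × adj G v w ≡ true × adj G w u ≡ true) →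
             adj G v u ≡ true ⊎ ∃ λ w → w ∈ S × adj G v w ≡ true × adj G w u ≡ true × f w ≢ C (edge w u)
    reach′ (inj₁ e) = inj₁ e
    reach′ {u} (inj₂ (u∈M , w , w∈ , vw , wu)) = inj₂ (w , w∈ , vw , wu ,
      λ eq → f∉ w (there (there (subst (_∈ map (λ u → C (edge w u)) M) (sym eq) (∈-map⁺ (λ u → C (edge w u)) u∈M)))))

  -- The new vertex gets the colour of its hub y, so that colour costs nothing extra.
  add-vertex-hub : {y : Fin n} → y ∈ S → adj G v y ≡ true → (N : List (Fin n)) → 2 + length N ≤ k → 3 ≤ k →
    (∀ {u} → u ∈ S → adj G v u ≡ true ⊎ u ∈ N × adj G y u ≡ true) → Colourable G k (v ∷ S)
  add-vertex-hub {y} y∈ vy N N< 3≤k reach = addVertex-two-step v (C (vert y)) f t v∉S (col<k t (vert y)) f<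
    (λ {z} _ → f-ok z) (λ u∈ → reach′ (reach u∈))
    where
    yFresh = freshColour (C (vert y) ∷ map (λ u → C (edge y u)) N) (subst (λ l → 2 + l ≤ k) (sym (length-map _ N)) N<)
    fresh : ∀ z → ∃ λ c → c < k × c ∉ C (vert y) ∷ C (vert z) ∷ []
    fresh z = freshColour _ 3≤k
    f′ : (z : Fin n) → Dec (z ≡ y) → ℕ
    f′ z (yes _) = proj₁ yFresh
    f′ z (no _)  = proj₁ (fresh z)
    f : Fin n → ℕ
    f z = f′ z (z ≟ y)
    f< : ∀ z → f z < k
    f< z with z ≟ y
    ... | yes _ = proj₁ (proj₂ yFresh)
    ... | no _  = proj₁ (proj₂ (fresh z))
    f-ok : ∀ z → f z ≢ C (vert y) × f z ≢ C (vert z)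
    f-ok z with z ≟ y
    ... | yes refl = (proj₂ (proj₂ yFresh) ∘ here) , (proj₂ (proj₂ yFresh) ∘ here)
    ... | no _     = (proj₂ (proj₂ (fresh z)) ∘ here) , (proj₂ (proj₂ (fresh z)) ∘ there ∘ here)
    f-edge : ∀ {u} → u ∈ N → f y ≢ C (edge y u)
    f-edge u∈ with y ≟ y
    ... | yes _ = λ eq → proj₂ (proj₂ yFresh) (there (subst (_∈ map (λ u → C (edge y u)) N) (sym eq) (∈-map⁺ (λ u → C (edge y u)) u∈)))
    ... | no ¬p = ⊥-elim (¬p refl)
    reach′ : ∀ {u} → adj G v u ≡ true ⊎ u ∈ N × adj G y u ≡ true →
             adj G v u ≡ true ⊎ ∃ λ w → w ∈ S × adj G v w ≡ true × adj G w u ≡ true × f w ≢ C (edge w u)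
    reach′ (inj₁ e)         = inj₁ e
    reach′ (inj₂ (u∈ , yu)) = inj₂ (y , y∈ , vy , yu , f-edge u∈)

  -- A second hub z serving the single vertex w saves one colour: the colour γ of the new vertex
  -- is chosen among those of z and zw, if possible such that y already has to avoid it.
  add-vertex-two-hubs : {y z w : Fin n} → y ∈ S → z ∈ S → w ∈ S → y ≢ z →
    adj G v y ≡ true → adj G v z ≡ true → adj G z w ≡ true →
    (N : List (Fin n)) → 2 + length N ≤ k → 3 ≤ k →
    (∀ {u} → u ∈ S → adj G v u ≡ true ⊎ u ≡ w ⊎ u ∈ N × adj G y u ≡ true) → Colourable G k (v ∷ S)
  add-vertex-two-hubs {y} {z} {w} y∈ z∈ w∈ y≢z vy vz zw N N< 3≤k reach = build choice
    where
    A = C (vert y) ∷ map (λ u → C (edge y u)) N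
    B = C (vert z) ∷ C (edge z w) ∷ []
    Choice : Set
    Choice = ∃₂ λ γ φ → γ ∈ B × φ < k × φ ∉ A × φ ≢ γ
    -- When γ already occurs in A, avoiding the 1 + |N| colours of A takes care of γ as well.
    fromA : ∀ {γ} → γ ∈ B → γ ∈ A → Choice
    fromA {γ} γ∈B γ∈A with φ , φ< , φ∉ ← freshColour A (subst (λ l → 2 + l ≤ k) (sym (length-map _ N)) N<) =
      γ , φ , γ∈B , φ< , φ∉ , λ { refl → φ∉ γ∈A }
    choice : Choice
    choice with C (vert z) ℕMem.∈? A | C (edge z w) ℕMem.∈? A
    ... | yes p | _     = fromA (here refl) p
    ... | no _  | yes p = fromA (there (here refl)) p
    -- Neither colour in B occurs in A: one of them serves as γ and the other as the colour of vy,
    -- and they differ by `proper`.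
    ... | no _  | no ¬p = C (vert z) , C (edge z w) , here refl , col<k t (edge z w) , ¬p , ≢-sym (proper t z∈ w∈ zw)
    -- Since γ is one of the two colours in B, avoiding B includes avoiding γ, and three colours
    -- suffice for the edge vz.
    zFresh = freshColour B 3≤k
    build : Choice → Colourable G k (v ∷ S)
    build (γ , φ , γ∈B , φ< , φ∉A , φ≢γ) = addVertex-two-step v γ f t v∉S γ< f< (λ {x} _ → f-ok x) (λ u∈ → reach′ (reach u∈))
      where
      γ< : γ < k
      γ< = All.lookup (col<k t (vert z) ∷ col<k t (edge z w) ∷ []) γ∈B
      fresh : ∀ x → ∃ λ c → c < k × c ∉ γ ∷ C (vert x) ∷ []
      fresh x = freshColour _ 3≤k
      f′ : (x : Fin n) → Dec (x ≡ y) → Dec (x ≡ z) → ℕ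
      f′ x (yes _) _       = φ
      f′ x (no _)  (yes _) = proj₁ zFresh
      f′ x (no _)  (no _)  = proj₁ (fresh x)
      f : Fin n → ℕ
      f x = f′ x (x ≟ y) (x ≟ z)
      f< : ∀ x → f x < k
      f< x with x ≟ y | x ≟ z
      ... | yes _ | _     = φ<
      ... | no _  | yes _ = proj₁ (proj₂ zFresh)
      ... | no _  | no _  = proj₁ (proj₂ (fresh x))
      f-ok : ∀ x → f x ≢ γ × f x ≢ C (vert x)
      f-ok x with x ≟ y | x ≟ z
      ... | yes refl | _        = φ≢γ , φ∉A ∘ here
      ... | no _     | yes refl = (λ eq → proj₂ (proj₂ zFresh) (subst (_∈ B) (sym eq) γ∈B)) , (proj₂ (proj₂ zFresh) ∘ here)
      ... | no _     | no _     = (proj₂ (proj₂ (fresh x)) ∘ here) , (proj₂ (proj₂ (fresh x)) ∘ there ∘ here)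
      fy : f y ≡ φ
      fy with y ≟ y
      ... | yes _ = refl
      ... | no ¬p = ⊥-elim (¬p refl)
      fz : f z ≡ proj₁ zFresh
      fz with z ≟ y | z ≟ z
      ... | yes p | _     = ⊥-elim (y≢z (sym p))
      ... | no _  | yes _ = refl
      ... | no _  | no ¬p = ⊥-elim (¬p refl)
      reach′ : ∀ {u} → adj G v u ≡ true ⊎ u ≡ w ⊎ u ∈ N × adj G y u ≡ true →
               adj G v u ≡ true ⊎ ∃ λ x → x ∈ S × adj G v x ≡ true × adj G x u ≡ true × f x ≢ C (edge x u)
      reach′ (inj₁ e)           = inj₁ e
      reach′ (inj₂ (inj₁ refl)) = inj₂ (z , z∈ , vz , zw , λ eq → proj₂ (proj₂ zFresh) (there (here (trans (sym fz) eq))))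
      reach′ (inj₂ (inj₂ (u∈ , yu))) = inj₂ (y , y∈ , vy , yu ,
        λ eq → φ∉A (there (subst (_∈ map (λ u → C (edge y u)) N) (trans (sym eq) fy) (∈-map⁺ (λ u → C (edge y u)) u∈))))

-- The induction step

-- At least three colours in each graph belong to the invariant because the hub arguments choose
-- edge colours that avoid two others.
Bounded : Graph n → Graph n → ℕ → List (Fin n) → Set
Bounded G H b S = ∃₂ λ k l → 3 ≤ k × 3 ≤ l × k + l ≤ b × Colourable G k S × Colourable H l S

bounded-swap : {G H : Graph n} {S : List (Fin n)} → Bounded G H m S → Bounded H G m S
bounded-swap (k , l , 3≤k , 3≤l , k+l≤ , s , t) = l , k , 3≤l , 3≤k , ≤-trans (≤-reflexive (+-comm l k)) k+l≤ , t , s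

bounded-↭ : {G H : Graph n} {S S′ : List (Fin n)} → S ↭ S′ → Bounded G H m S → Bounded G H m S′
bounded-↭ p (k , l , 3≤k , 3≤l , k+l≤ , s , t) = k , l , 3≤k , 3≤l , k+l≤ , Colourable-↭ p s , Colourable-↭ p t

neighbours : Graph n → Fin n → List (Fin n) → List (Fin n)
neighbours G v S = filter (λ u → adj G v u Bool.≟ true) S

neighbours-partition : {G H : Graph n} → Complementary G H → {v : Fin n} (S : List (Fin n)) → v ∉ S →
                       S ↭ neighbours G v S ++ neighbours H v S
neighbours-partition comp [] _ = ↭-refl
neighbours-partition {G = G} {H} comp {v} (u ∷ S) v∉
  with ih ← neighbours-partition comp S (v∉ ∘ there)
  with adj G v u in e | adj H v u in e′
... | true  | false = ↭-prep u ih
... | false | true  = ↭-trans (↭-prep u ih) (↭-sym (shift u (neighbours G v S) (neighbours H v S)))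
... | true  | true  = ⊥-elim (true≢false e′ (co-false comp e))
... | false | false = ⊥-elim (true≢false (co-true comp (λ p → v∉ (here p)) e) e′)

module Step {G H : Graph n} (comp : Complementary G H) {S : List (Fin n)} {v : Fin n} (unique : Unique (v ∷ S))
            (cG : CutConnected G S)
            {k l : ℕ} (3≤k : 3 ≤ k) (3≤l : 3 ≤ l) (k+l≤ : k + l ≤ 2 * length S)
            (tG : Colourable G k S) (tH : Colourable H l S)
            {w₀ : Fin n} (w₀∈ : w₀ ∈ S) (vw₀ : adj G v w₀ ≡ true) where

  v∉S : v ∉ S
  v∉S = Unique[x∷xs]⇒x∉xs unique
  N M : List (Fin n)
  N = neighbours G v S
  M = neighbours H v S
  d e : ℕ
  d = length N
  e = length M
  S↭ : S ↭ N ++ M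
  S↭ = neighbours-partition comp S v∉S
  d+e : length S ≡ d + e
  d+e = trans (↭-length S↭) (length-++ N)
  ∈N : ∀ {u} → u ∈ N → u ∈ S × adj G v u ≡ true
  ∈N = ∈-filter⁻ (λ u → adj G v u Bool.≟ true)
  ∈M : ∀ {u} → u ∈ M → u ∈ S × adj H v u ≡ true
  ∈M = ∈-filter⁻ (λ u → adj H v u Bool.≟ true)
  N⊎M : ∀ {u} → u ∈ S → u ∈ N ⊎ u ∈ M
  N⊎M u∈ = ∈-++⁻ N (∈-resp-↭ S↭ u∈)
  N≢M : ∀ {u w} → u ∈ N → w ∈ M → u ≢ w
  N≢M u∈ w∈ refl = true≢false (proj₂ (∈M w∈)) (co-false comp (proj₂ (∈N u∈)))
  w₀∈N : w₀ ∈ N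
  w₀∈N = ∈-filter⁺ (λ u → adj G v u Bool.≟ true) w₀∈ vw₀

  -- In G such a y has distance at least three from v. In H it is adjacent to v and to all of N, so
  -- it is a hub from which v reaches N.
  module Far {y : Fin n} (y∈M : y ∈ M) (far : ∀ {w} → w ∈ N → adj G y w ≡ false) where

    y∈ = proj₁ (∈M y∈M)
    vy = proj₂ (∈M y∈M)
    yN : ∀ {w} → w ∈ N → adj H y w ≡ true
    yN w∈ = co-true comp (≢-sym (N≢M w∈ y∈M)) (far w∈)

    hub-H : ∀ {l} → Colourable H l S → 2 + d ≤ l → 3 ≤ l → Colourable H l (v ∷ S)
    hub-H (_ , t) d≤l 3≤l = add-vertex-hub t v∉S y∈ vy N d≤l 3≤l reach
      where
      reach : ∀ {u} → u ∈ S → adj H v u ≡ true ⊎ u ∈ N × adj H y u ≡ true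
      reach u∈ with N⊎M u∈
      ... | inj₁ u∈N = inj₂ (u∈N , yN u∈N)
      ... | inj₂ u∈M = inj₁ (proj₂ (∈M u∈M))

    large-l : 2 + d ≤ l → Bounded G H (2 * suc (length S)) (v ∷ S)
    large-l d≤l = 2 + k , l , m≤n⇒m≤1+n (m≤n⇒m≤1+n 3≤k) , 3≤l ,
      ≤-trans (+-monoʳ-≤ 2 k+l≤) (≤-reflexive (sym (*-suc 2 (length S)))) ,
      add-pendant v w₀∈ (adj-swap G vw₀) tG , hub-H tH d≤l 3≤l

    star-G : Colourable G (2 * e + (d + 1)) (v ∷ S)
    star-G = Colourable-↭ perm (spanning-growth e (N ++ [ v ]) M refl (∈-++⁺ʳ N (here refl)) (Unique-resp-↭ (↭-sym perm) unique)
      (cutConnected-resp (↭-sym perm) (cutConnected-∷ w₀∈ vw₀ cG))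
      (Sat⇒Colourable (attachAll N (here refl) (All.tabulate (proj₂ ∘ ∈N)) (singleton-colourable G v))))
      where
      perm : (N ++ [ v ]) ++ M ↭ v ∷ S
      perm = ↭-trans (Perm.++-assoc N [ v ] M) (↭-trans (shift v N M) (↭-prep v (↭-sym S↭)))

    -- With l this small, the given colouring of G is abandoned: G is coloured afresh along a
    -- spanning tree, while H is allowed d + 1 or d + 2 colours.
    module Small (l≤ : l ≤ suc d) where

      two-hubs : ∀ {z w} → z ∈ M → y ≢ z → w ∈ N → adj G z w ≡ false → Bounded G H (2 * suc (length S)) (v ∷ S)
      two-hubs {z} {w} z∈M y≢z w∈N zw with N′ , N↭ ← ∈⇒↭ w∈N with _ , t ← Colourable-≤ l≤ tH =
        -- In G the star at v takes d + 1 colours and M another 2e. In H the second hub z serves w,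
        -- leaving d - 1 vertices to y, so d + 1 colours do. The sum is exactly 2(d + e + 1).
        2 * e + (d + 1) , suc d , 3≤star , ≤-trans 3≤l l≤ , ≤-reflexive total , star-G ,
        add-vertex-two-hubs t v∉S y∈ (proj₁ (∈M z∈M)) (proj₁ (∈N w∈N)) y≢z vy (proj₂ (∈M z∈M))
          (co-true comp (≢-sym (N≢M w∈N z∈M)) zw) N′ (≤-reflexive (cong suc (sym (↭-length N↭)))) (≤-trans 3≤l l≤) reach
        where
        3≤star : 3 ≤ 2 * e + (d + 1)
        3≤star = ≤-trans 3≤l (≤-trans l≤ (≤-trans (≤-reflexive (+-comm 1 d)) (m≤n+m (d + 1) (2 * e))))
        total : 2 * e + (d + 1) + suc d ≡ 2 * suc (length S)
        total = trans (solve 2 (λ d e → con 2 :* e :+ (d :+ con 1) :+ (con 1 :+ d) := con 2 :* (con 1 :+ (d :+ e))) refl d e)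
                      (cong (λ s → 2 * suc s) (sym d+e))
          where open +-*-Solver
        reach : ∀ {u} → u ∈ S → adj H v u ≡ true ⊎ u ≡ w ⊎ u ∈ N′ × adj H y u ≡ true
        reach u∈ with N⊎M u∈
        ... | inj₂ u∈M = inj₁ (proj₂ (∈M u∈M))
        ... | inj₁ u∈N with ∈-resp-↭ N↭ u∈N
        ... | here p   = inj₂ (inj₁ p)
        ... | there p  = inj₂ (inj₂ (p , yN u∈N))

      -- As G is connected on S and y has no G-neighbour in N, it has one in M.
      y-neighbour : ∃ λ a → a ∈ M × a ≢ y × adj G a y ≡ true
      y-neighbour with S′ , p ← ∈⇒↭ y∈ with ∈-resp-↭ p w₀∈
      ... | here q = ⊥-elim (N≢M w₀∈N y∈M q)
      ... | there w₀∈′ with a , a∈′ , ya ← neighbour (Unique[x∷xs]⇒x∉xs (Unique-resp-↭ p (AllPairs.tail unique))) w₀∈′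
                                             (cutConnected-resp p cG)
        with N⊎M (∈-resp-↭ (↭-sym p) (there a∈′))
      ... | inj₁ a∈N = ⊥-elim (true≢false ya (far a∈N))
      ... | inj₂ a∈M = a , a∈M , ≢-sym (adj⇒≢ G ya) , adj-swap G ya

      -- The edge w₀a dominates G.
      dominating-edge : (∀ {z w} → z ∈ M → z ≢ y → w ∈ N → adj G z w ≡ true) → Bounded G H (2 * suc (length S)) (v ∷ S)
      dominating-edge full with a , a∈M , a≢y , ay ← y-neighbour
        with M′ , M↭ ← ∈⇒↭ y∈M | N′ , N↭ ← ∈⇒↭ w₀∈N with ∈-resp-↭ M↭ a∈M
      ... | here q = ⊥-elim (a≢y q)
      ... | there a∈M′ =
        -- The star at `w₀` has e leaves, namely v and M without y, and takes e + 1 colours.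
        -- Saturating a costs one more, and its leaves y and N without `w₀` cost d. The sum |S| + 2
        -- + (2 + d) fits because a and y both lie in M, so e ≥ 2.
        length N⁺ + suc (length M⁺ + 1) , 2 + d , 3≤G , m≤n⇒m≤1+n (≤-trans 3≤l l≤) , total ,
        Colourable-↭ perm (Sat⇒Colourable (attachAll N⁺ (∈-++⁺ˡ (there a∈M′)) (ay ∷ All.tabulate aN′)
          (saturate a (∈-++⁺ˡ (there a∈M′)) (Sat⇒Colourable
            (attachAll M⁺ (here refl) (adj-swap G vw₀ ∷ All.tabulate w₀M′) (singleton-colourable G w₀)))))) ,
        hub-H (Colourable-≤ (m≤n⇒m≤1+n l≤) tH) ≤-refl (m≤n⇒m≤1+n (≤-trans 3≤l l≤))
        where
        N⁺ = y ∷ N′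
        M⁺ = v ∷ M′
        aN′ : ∀ {w} → w ∈ N′ → adj G a w ≡ true
        aN′ w∈ = full a∈M a≢y (∈-resp-↭ (↭-sym N↭) (there w∈))
        y∉M′ : y ∉ M′
        y∉M′ = Unique[x∷xs]⇒x∉xs (Unique-resp-↭ M↭ (UniqueP.filter⁺ (λ u → adj H v u Bool.≟ true) (AllPairs.tail unique)))
        w₀M′ : ∀ {z} → z ∈ M′ → adj G w₀ z ≡ true
        w₀M′ z∈ = adj-swap G (full (∈-resp-↭ (↭-sym M↭) (there z∈)) (λ { refl → y∉M′ z∈ }) w₀∈N)
        e≡ : e ≡ length M⁺
        e≡ = ↭-length M↭
        d≡ : d ≡ length N⁺
        d≡ = ↭-length N↭
        G≡ : length N⁺ + suc (length M⁺ + 1) ≡ 2 + length S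
        G≡ = begin
          length N⁺ + suc (length M⁺ + 1) ≡⟨ cong₂ (λ d e → d + suc (e + 1)) (sym d≡) (sym e≡) ⟩
          d + suc (e + 1)                 ≡⟨ solve 2 (λ d e → d :+ (con 1 :+ (e :+ con 1)) := con 2 :+ (d :+ e)) refl d e ⟩
          2 + (d + e)                     ≡⟨ cong (2 +_) (sym d+e) ⟩
          2 + length S                    ∎
          where
          open ≡-Reasoning
          open +-*-Solver
        3≤G : 3 ≤ length N⁺ + suc (length M⁺ + 1)
        3≤G = ≤-trans (+-monoʳ-≤ 2 (≤-trans (s≤s z≤n) (≤-reflexive (sym (↭-length (proj₂ (∈⇒↭ w₀∈))))))) (≤-reflexive (sym G≡))
        2≤e : 2 ≤ e
        2≤e = subst (2 ≤_) (sym e≡) (s≤s (≤-trans (s≤s z≤n) (≤-reflexive (sym (↭-length (proj₂ (∈⇒↭ a∈M′)))))))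
        total : length N⁺ + suc (length M⁺ + 1) + (2 + d) ≤ 2 * suc (length S)
        total = begin
          length N⁺ + suc (length M⁺ + 1) + (2 + d) ≡⟨ cong₂ _+_ G≡ (+-comm 2 d) ⟩
          2 + length S + (d + 2)                    ≤⟨ +-monoʳ-≤ (2 + length S) (+-monoʳ-≤ d 2≤e) ⟩
          2 + length S + (d + e)                    ≡⟨ cong (2 + length S +_) (sym d+e) ⟩
          2 + length S + length S                   ≡⟨ solve 1 (λ s → con 2 :+ s :+ s := con 2 :* (con 1 :+ s)) refl (length S) ⟩
          2 * suc (length S)                        ∎
          where
          open ≤-Reasoning
          open +-*-Solver
        perm : N⁺ ++ (M⁺ ++ [ w₀ ]) ↭ v ∷ S
        perm = ↭-trans (shift v N⁺ (M′ ++ [ w₀ ])) (↭-prep v (↭-trans rest (↭-sym S↭)))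
          where
          rest : N⁺ ++ (M′ ++ [ w₀ ]) ↭ N ++ M
          rest = ↭-trans (↭-prep y (↭-trans (Perm.++⁺ˡ N′ (Perm.++-comm M′ [ w₀ ])) (shift w₀ N′ M′)))
                 (↭-trans (↭-sym (shift y (w₀ ∷ N′) M′)) (Perm.++⁺ (↭-sym N↭) (↭-sym M↭)))

    far-step : Bounded G H (2 * suc (length S)) (v ∷ S)
    far-step with 2 + d ≤? l
    ... | yes d≤l = large-l d≤l
    ... | no d≰l with Any.any? (λ z → ¬? (y ≟ z) ×-dec Any.any? (λ w → adj G z w Bool.≟ false) N) M
    ... | yes any with z , z∈ , y≢z , any′ ← find any with w , w∈ , zw ← find any′ =
      Small.two-hubs (s≤s⁻¹ (≰⇒> d≰l)) z∈ y≢z w∈ zw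
    ... | no ¬any = Small.dominating-edge (s≤s⁻¹ (≰⇒> d≰l)) λ z∈ z≢y w∈ →
      ¬-not (λ zw → ¬any (lose z∈ (≢-sym z≢y , lose w∈ zw)))

-- If some vertex has distance at least three from v in G or in H, `Far` applies, in the second case
-- with the graphs exchanged. Otherwise every vertex is within distance two of v in both, and
-- `add-vertex-radius-two` is available in whichever graph has colours enough.
extend : {G H : Graph n} → Complementary G H → {S : List (Fin n)} {v : Fin n} → Unique (v ∷ S) →
         4 ≤ length S → CutConnected G S → CutConnected H S →
         (∃ λ w → w ∈ S × adj G v w ≡ true) → (∃ λ w → w ∈ S × adj H v w ≡ true) →
         Bounded G H (2 * length S) S → Bounded G H (2 * suc (length S)) (v ∷ S)
extend {n} {G} {H} comp {S} {v} unique 4≤ cG cH (w , w∈ , vw) (x , x∈ , vx) (k , l , 3≤k , 3≤l , k+l≤ , tG , tH)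
  with Any.any? (λ y → All.all? (λ w → adj G y w Bool.≟ false) (neighbours G v S)) (neighbours H v S)
     | Any.any? (λ y → All.all? (λ w → adj H y w Bool.≟ false) (neighbours H v S)) (neighbours G v S)
... | yes any | _ with y , y∈ , far ← find any =
  Step.Far.far-step comp unique cG 3≤k 3≤l k+l≤ tG tH w∈ vw y∈ (All.lookup far)
... | no _ | yes any with y , y∈ , far ← find any =
  bounded-swap (Step.Far.far-step (complementary-sym comp) unique cH 3≤l 3≤k
    (≤-trans (≤-reflexive (+-comm l k)) k+l≤) tH tG x∈ vx y∈ (All.lookup far))
... | no ¬farG | no ¬farH = near
  where
  module A = Step comp unique cG 3≤k 3≤l k+l≤ tG tH w∈ vw
  open A using (N; M; d; e; d+e; v∉S)
  extend-G : ∀ {k} → Colourable G k S → 3 + e ≤ k → Colourable G k (v ∷ S)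
  extend-G (_ , t) e≤k = add-vertex-radius-two t v∉S M e≤k reach
    where
    reach : ∀ {u} → u ∈ S → adj G v u ≡ true ⊎ u ∈ M × ∃ λ w → w ∈ S × adj G v w ≡ true × adj G w u ≡ true
    reach {u} u∈ with A.N⊎M u∈
    ... | inj₁ u∈N = inj₁ (proj₂ (A.∈N u∈N))
    ... | inj₂ u∈M with Any.any? (λ w → adj G w u Bool.≟ true) N
    ... | yes any with w , w∈ , wu ← find any = inj₂ (u∈M , w , proj₁ (A.∈N w∈) , proj₂ (A.∈N w∈) , wu)
    ... | no ¬any = ⊥-elim (¬farG (lose u∈M (All.tabulate λ w∈ → ¬-not (λ uw → ¬any (lose w∈ (adj-swap G uw))))))
  extend-H : ∀ {l} → Colourable H l S → 3 + d ≤ l → Colourable H l (v ∷ S)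
  extend-H (_ , t) d≤l = add-vertex-radius-two t v∉S N d≤l reach
    where
    reach : ∀ {u} → u ∈ S → adj H v u ≡ true ⊎ u ∈ N × ∃ λ w → w ∈ S × adj H v w ≡ true × adj H w u ≡ true
    reach {u} u∈ with A.N⊎M u∈
    ... | inj₂ u∈M = inj₁ (proj₂ (A.∈M u∈M))
    ... | inj₁ u∈N with Any.any? (λ w → adj H w u Bool.≟ true) M
    ... | yes any with w , w∈ , wu ← find any = inj₂ (u∈N , w , proj₁ (A.∈M w∈) , proj₂ (A.∈M w∈) , wu)
    ... | no ¬any = ⊥-elim (¬farH (lose u∈N (All.tabulate λ w∈ → ¬-not (λ uw → ¬any (lose w∈ (adj-swap H uw))))))
  2+≤ : 2 + (k + l) ≤ 2 * suc (length S)
  2+≤ = ≤-trans (+-monoʳ-≤ 2 k+l≤) (≤-reflexive (sym (*-suc 2 (length S))))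
  near : Bounded G H (2 * suc (length S)) (v ∷ S)
  near with 3 + e ≤? k | 3 + d ≤? l
  ... | yes e≤k | _ = k , 2 + l , 3≤k , m≤n⇒m≤1+n (m≤n⇒m≤1+n 3≤l) ,
        ≤-trans (≤-reflexive (trans (+-suc k (suc l)) (cong suc (+-suc k l)))) 2+≤ ,
        extend-G tG e≤k , add-pendant v x∈ (adj-swap H vx) tH
  ... | no _ | yes d≤l = 2 + k , l , m≤n⇒m≤1+n (m≤n⇒m≤1+n 3≤k) , 3≤l , 2+≤ ,
        add-pendant v w∈ (adj-swap G vw) tG , extend-H tH d≤l
  -- Both numbers fall short, so both are raised to the thresholds 3 + e and 3 + d, and v is then
  -- added at no further cost. The sum |S| + 6 is at most 2|S| + 2 since |S| ≥ 4.
  ... | no e≰k | no d≰l = 3 + e , 3 + d , m≤m+n 3 e , m≤m+n 3 d , total ,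
        extend-G (Colourable-≤ (<⇒≤ (≰⇒> e≰k)) tG) ≤-refl , extend-H (Colourable-≤ (<⇒≤ (≰⇒> d≰l)) tH) ≤-refl
    where
    total : 3 + e + (3 + d) ≤ 2 * suc (length S)
    total = begin
      3 + e + (3 + d)         ≡⟨ solve 2 (λ d e → con 3 :+ e :+ (con 3 :+ d) := con 2 :+ (d :+ e) :+ con 4) refl d e ⟩
      2 + (d + e) + 4         ≡⟨ cong (λ s → 2 + s + 4) (sym d+e) ⟩
      2 + length S + 4        ≤⟨ +-monoʳ-≤ (2 + length S) 4≤ ⟩
      2 + length S + length S ≡⟨ solve 1 (λ s → con 2 :+ s :+ s := con 2 :* (con 1 :+ s)) refl (length S) ⟩
      2 * suc (length S)      ∎
      where
      open ≤-Reasoning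
      open +-*-Solver

-- Certified colourings of small graphs

Adjacency : ℕ → Set
Adjacency m = Fin m → Fin m → Bool

coAdjacency : Adjacency m → Adjacency m
coAdjacency A i j with i ≟ j
... | yes _ = false
... | no _  = not (A i j)

consAdjacency : Vec Bool m → Adjacency m → Adjacency (suc m)
consAdjacency N A zero    zero    = false
consAdjacency N A zero    (suc j) = Vec.lookup N j
consAdjacency N A (suc i) zero    = Vec.lookup N i
consAdjacency N A (suc i) (suc j) = A i j

-- A colouring is coded by the decimal digits, lowest first, of the colours of vertex 0 and of the edges
-- from 0 to 1, 2, …, followed by those of vertex 1 and of the edges from 1 to 2, 3, …, and so on.
digit : ℕ → ℕ → ℕ
digit code zero    = code % 10
digit code (suc i) = digit (code / 10) i

dropDigits : ℕ → ℕ → ℕ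
dropDigits zero    code = code
dropDigits (suc m) code = dropDigits m (code / 10)

entry : ℕ → Fin m → Fin m → ℕ
entry         code zero    j       = digit code (toℕ j)
entry         code (suc i) zero    = digit code (toℕ (suc i))
entry {suc m} code (suc i) (suc j) = entry (dropDigits (suc m) code) i j

entry-sym : (code : ℕ) (i j : Fin m) → entry code i j ≡ entry code j i
entry-sym code zero    zero    = refl
entry-sym code zero    (suc j) = refl
entry-sym code (suc i) zero    = refl
entry-sym code (suc i) (suc j) = entry-sym _ i j

decode : ℕ → Item m → ℕ
decode code (edge i j) = entry code i j
decode code (vert i)   = entry code i i

walks : Adjacency m → ℕ → Fin m → List (List (Fin m))
walks A zero    u = [] ∷ []
walks A (suc r) u = concatMap (λ y → map (y ∷_) (walks A r y)) (filter (λ y → A u y Bool.≟ true) (allFin _))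

-- Candidates with at most m - 2 internal vertices, which is all that a path between distinct ends
-- can have. Following edges of A keeps the search small; `IsRainbow` verifies each candidate in
-- full.
interiors : Adjacency m → Fin m → List (List (Fin m))
interiors {m} A u = concatMap (λ r → walks A r u) (upTo (m ∸ 1))

IsRainbow : Adjacency m → ℕ → Fin m → Fin m → List (Fin m) → Set
IsRainbow A code u w ys =
  All (IsEdge A) (items u ys w) × u ∉ ys × w ∉ ys × Unique (map (decode code) (items u ys w))

Valid : Adjacency m → ℕ → ℕ → Set
Valid {m} A k code = ∀ (i j : Fin m) → entry code i j < k ×
  (A i j ≡ false ⊎ entry code i i ≢ entry code i j) ×
  (i ≡ j ⊎ Any (IsRainbow A code i j) (interiors A i))

isEdge? : (A : Adjacency m) → Decidable (IsEdge A)
isEdge? A (edge u w) = A u w Bool.≟ true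
isEdge? A (vert u)   = yes _

valid? : (A : Adjacency m) (k code : ℕ) → Dec (Valid A k code)
valid? {m} A k code = FinP.all? λ i → FinP.all? λ j → (entry code i j <? k) ×-dec
  ((A i j Bool.≟ false) ⊎-dec ¬? (entry code i i ℕ.≟ entry code i j)) ×-dec
  ((i ≟ j) ⊎-dec Any.any? (λ ys → All.all? (isEdge? A) (items i ys j) ×-dec (i VMem.∉? ys) ×-dec (j VMem.∉? ys) ×-dec
                                  DecUnique.unique? ℕ._≟_ (map (decode code) (items i ys j))) (interiors A i))

record Represents (G : Graph n) (l : List (Fin n)) (A : Adjacency (length l)) : Set where
  field entries : ∀ i j → adj G (lookup l i) (lookup l j) ≡ A i j
open Represents public

represents-∷ : {G : Graph n} {l : List (Fin n)} {A : Adjacency (length l)} {v : Fin n} (N : Vec Bool (length l)) →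
  (∀ i → adj G v (lookup l i) ≡ Vec.lookup N i) → Represents G l A → Represents G (v ∷ l) (consAdjacency N A)
represents-∷ {G = G} {v = v} N row rep .entries zero    zero    = adjIrrefl G v
represents-∷                 N row rep .entries zero    (suc j) = row j
represents-∷ {G = G}         N row rep .entries (suc i) zero    = adj-swap G (row i)
represents-∷                 N row rep .entries (suc i) (suc j) = entries rep i j

lookup-injective : {l : List (Fin n)} → Unique l → ∀ i j → lookup l i ≡ lookup l j → i ≡ j
lookup-injective (_ ∷ _)   zero    zero    _  = refl
lookup-injective (p ∷ _)   zero    (suc j) eq = ⊥-elim (All.lookup p (∈-lookup j) eq)
lookup-injective (p ∷ _)   (suc i) zero    eq = ⊥-elim (All.lookup p (∈-lookup i) (sym eq))
lookup-injective (_ ∷ u)   (suc i) (suc j) eq = cong suc (lookup-injective u i j eq)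

represents-complement : {G H : Graph n} {l : List (Fin n)} {A : Adjacency (length l)} → Complementary G H → Unique l →
                        Represents G l A → Represents H l (coAdjacency A)
represents-complement {H = H} {l} comp u rep .entries i j with i ≟ j
... | yes refl = adjIrrefl H (lookup l i)
... | no i≢j   = trans (opposite comp (i≢j ∘ lookup-injective u i j)) (cong not (entries rep i j))

valid⇒colourable : {G : Graph n} {x : Fin n} {xs : List (Fin n)} (let l = x ∷ xs) {A : Adjacency (length l)} {code : ℕ} →
                   Unique l → Represents G l A → Valid A k code → Colourable G k l
valid⇒colourable {n} {k} {G} {x} {xs} {A} {code} uniq rep valid = colouring c⁺ c⁺-sym , record
  { col<k  = bound
  ; proper = proper⁺
  ; path   = path⁺
  }
  where
  l = x ∷ xs
  I = Fin (length l)
  C = decode {length l} code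
  inv′ : (v : Fin n) → Dec (v ∈ l) → I
  inv′ v (yes p) = index p
  -- Vertices outside l take the colours belonging to index `zero`; the bound on the colours is the
  -- only condition that concerns them.
  inv′ v (no _)  = zero
  inv : Fin n → I
  inv v = inv′ v (v VMem.∈? l)
  inv-lookup : ∀ i → inv (lookup l i) ≡ i
  inv-lookup i with lookup l i VMem.∈? l
  ... | yes p = lookup-injective uniq (index p) i (sym (lookup-index p))
  ... | no ¬p = ⊥-elim (¬p (∈-lookup i))
  pull : Item n → Item (length l)
  pull (edge u w) = edge (inv u) (inv w)
  pull (vert u)   = vert (inv u)
  push : Item (length l) → Item n
  push (edge i j) = edge (lookup l i) (lookup l j)
  push (vert i)   = vert (lookup l i)
  pull-push : ∀ i → pull (push i) ≡ i
  pull-push (edge i j) = cong₂ edge (inv-lookup i) (inv-lookup j)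
  pull-push (vert i)   = cong vert (inv-lookup i)
  c⁺ : Item n → ℕ
  c⁺ = C ∘ pull
  c⁺-sym : ∀ u w → c⁺ (edge u w) ≡ c⁺ (edge w u)
  c⁺-sym u w = entry-sym code (inv u) (inv w)
  bound : ∀ i → c⁺ i < k
  bound (edge u w) = proj₁ (valid (inv u) (inv w))
  bound (vert u)   = proj₁ (valid (inv u) (inv u))
  items-map : ∀ i ys j → items (lookup l i) (map (lookup l) ys) (lookup l j) ≡ map push (items i ys j)
  items-map i []       j = refl
  items-map i (y ∷ ys) j = cong (λ r → _ ∷ _ ∷ r) (items-map y ys j)
  proper′ : ∀ i j → adj G (lookup l i) (lookup l j) ≡ true → c⁺ (vert (lookup l i)) ≢ c⁺ (edge (lookup l i) (lookup l j))
  proper′ i j e eq with proj₁ (proj₂ (valid i j))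
  ... | inj₁ f  = true≢false e (trans (entries rep i j) f)
  ... | inj₂ ne = ne (trans (sym (cong C (pull-push (vert i)))) (trans eq (cong C (pull-push (edge i j)))))
  proper⁺ : ∀ {u w} → u ∈ l → w ∈ l → adj G u w ≡ true → c⁺ (vert u) ≢ c⁺ (edge u w)
  proper⁺ u∈ w∈ e rewrite lookup-index u∈ | lookup-index w∈ = proper′ (index u∈) (index w∈) e
  ∉-map : ∀ {i ys} → i ∉ ys → lookup l i ∉ map (lookup l) ys
  ∉-map {i} {ys} i∉ p with j , j∈ , eq ← ∈-map⁻ (lookup l) p = i∉ (subst (_∈ ys) (sym (lookup-injective uniq i j eq)) j∈)
  pushEdge : ∀ {i} → IsEdge A i → IsEdge (adj G) (push i)
  pushEdge {edge i j} e = trans (entries rep i j) e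
  pushEdge {vert i}   e = e
  path′ : ∀ i j → lookup l i ≢ lookup l j → RainbowPath G c⁺ l (lookup l i) (lookup l j)
  path′ i j ne with proj₂ (proj₂ (valid i j))
  ... | inj₁ refl = ⊥-elim (ne refl)
  ... | inj₂ any with ys , _ , edges , i∉ , j∉ , u ← find any =
    rainbowPath (map (lookup l) ys)
      (subst (All (IsEdge (adj G))) (sym (items-map i ys j)) (AllP.map⁺ (All.map pushEdge edges)))
      (∉-map i∉) (∉-map j∉) (AllP.map⁺ (All.tabulate λ {y} _ → ∈-lookup y))
      (subst Unique (sym (trans (cong (map c⁺) (items-map i ys j))
        (trans (sym (map-∘ (items i ys j))) (map-cong (cong C ∘ pull-push) (items i ys j))))) u)
  path⁺ : ∀ {u w} → u ∈ l → w ∈ l → u ≢ w → RainbowPath G c⁺ l u w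
  path⁺ u∈ w∈ ne = subst₂ (RainbowPath G c⁺ l) (sym (lookup-index u∈)) (sym (lookup-index w∈))
    (path′ (index u∈) (index w∈) (λ eq → ne (trans (lookup-index u∈) (trans eq (sym (lookup-index w∈))))))

record Certificate : Set where
  constructor certificate
  field
    coloursG codeG coloursH codeH : ℕ

BoundedBy : List Certificate → ℕ → Adjacency m → Set
BoundedBy table b A = Any (λ (certificate k code l code′) →
  k + l ≤ b × 3 ≤ k × 3 ≤ l × Valid A k code × Valid (coAdjacency A) l code′) table

boundedBy? : (table : List Certificate) (b : ℕ) (A : Adjacency m) → Dec (BoundedBy table b A)
boundedBy? table b A = Any.any? (λ (certificate k code l code′) →
  (k + l ≤? b) ×-dec (3 ≤? k) ×-dec (3 ≤? l) ×-dec valid? A k code ×-dec valid? (coAdjacency A) l code′) table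

boundedBy⇒bounded : {G H : Graph n} {x : Fin n} {xs : List (Fin n)} (let l = x ∷ xs) {A : Adjacency (length l)} {table : List Certificate} {b : ℕ} →
  Complementary G H → Unique l → Represents G l A → BoundedBy table b A → Bounded G H b l
boundedBy⇒bounded comp u rep any with certificate k _ l _ , _ , k+l≤ , 3≤k , 3≤l , vG , vH ← find any =
  k , l , 3≤k , 3≤l , k+l≤ , valid⇒colourable u rep vG , valid⇒colourable u (represents-complement comp u rep) vH

all-Vec? : {P : Vec Bool m → Set} → (∀ N → Dec (P N)) → Dec (∀ N → P N)
all-Vec? {zero}  P? = map′ (λ { p [] → p }) (λ f → f []) (P? [])
all-Vec? {suc m} P? = map′ (λ { (p , q) (true ∷ N) → p N ; (p , q) (false ∷ N) → q N })
  (λ f → (λ N → f (true ∷ N)) , (λ N → f (false ∷ N)))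
  (all-Vec? (λ N → P? (true ∷ N)) ×-dec all-Vec? (λ N → P? (false ∷ N)))

-- A new vertex with such a row would be isolated in one of the two graphs.
Constant : Vec Bool m → Set
Constant N = N ≡ replicate _ true ⊎ N ≡ replicate _ false

constant? : (N : Vec Bool m) → Dec (Constant N)
constant? N = VecP.≡-dec Bool._≟_ N _ ⊎-dec VecP.≡-dec Bool._≟_ N _

P₄-adjacency : Adjacency 4
P₄-adjacency = consAdjacency (true ∷ false ∷ false ∷ []) (consAdjacency (true ∷ false ∷ []) (consAdjacency (true ∷ []) (consAdjacency [] λ ())))

-- The neighbourhoods in P₄ for which the extension is the fork (P₄ with an additional leaf at an
-- internal vertex) or its complement are the only ones where the sum on five vertices is 11;
-- each comes with colourings of the graphs on six vertices that extend it.
forks : List (Vec Bool 4 × List Certificate)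
forks =
  ((false ∷ true ∷ false ∷ false ∷ []) ,
    certificate 7 640323155024155166662 5 141001232430412443340 ∷
    certificate 8 104436127166225555512 4 323031100312123112203 ∷
    certificate 5 404120224304112214413 7 15225324543106411236 ∷ []) ∷
  ((false ∷ false ∷ true ∷ false ∷ []) ,
    certificate 7 53520134651425666162 5 421301204114032334440 ∷
    certificate 8 176234140122665555512 4 301033102321213221103 ∷
    certificate 5 340224210411402441213 7 545225321001346211436 ∷ []) ∷
  ((true ∷ true ∷ true ∷ false ∷ []) ,
    certificate 5 101224043143102343440 7 336510245012545616662 ∷
    certificate 4 103013320311223212103 8 641711302426265555512 ∷
    certificate 7 520435212514036142136 5 14423202410142424113 ∷ []) ∷
  ((false ∷ true ∷ true ∷ true ∷ []) ,
    certificate 5 134421020101342434340 7 50416253345215661662 ∷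
    certificate 4 303213300122113121203 8 421011374662625555512 ∷
    certificate 7 525130242530416124136 5 423024241041012142413 ∷ []) ∷ []

table₅ : List Certificate
table₅ =
  certificate 5 420031014134321 5 120213043321140 ∷
  certificate 3 102112120220001 7 243123656024433 ∷
  certificate 5 12430024111443 5 203331101402214 ∷
  certificate 7 105032644666514 3 101022201100102 ∷
  certificate 5 410023204032031 6 333005544120224 ∷
  certificate 6 42253400201144 5 404334123320041 ∷ []

IsFork : Vec Bool 4 → Set
IsFork N = Any (λ (F , _) → N ≡ F) forks

abstract
  check₅ : (N : Vec Bool 4) → Constant N ⊎ BoundedBy table₅ 10 (consAdjacency N P₄-adjacency) ⊎
           IsFork N × BoundedBy table₅ 11 (consAdjacency N P₄-adjacency)
  check₅ = toWitness {a? = all-Vec? λ N → constant? N ⊎-dec boundedBy? table₅ 10 _ ⊎-dec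
    (Any.any? (λ (F , _) → VecP.≡-dec Bool._≟_ N F) forks ×-dec boundedBy? table₅ 11 _)} _

  check₆ : All (λ (F , table) → ∀ N → Constant N ⊎ BoundedBy table 12 (consAdjacency N (consAdjacency F P₄-adjacency))) forks
  check₆ = toWitness {a? = All.all? (λ (F , table) → all-Vec? λ N → constant? N ⊎-dec boundedBy? table 12 _) forks} _

-- The upper bound from five vertices on

row : Graph n → Fin n → (l : List (Fin n)) → Vec Bool (length l)
row G v l = Vec.tabulate (λ i → adj G v (lookup l i))

row-lookup : (G : Graph n) (v : Fin n) (l : List (Fin n)) → ∀ i → adj G v (lookup l i) ≡ Vec.lookup (row G v l) i
row-lookup G v l i = sym (VecP.lookup∘tabulate _ i)

row-nonconstant : {G H : Graph n} {v : Fin n} {l : List (Fin n)} → Complementary G H →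
  (∃ λ w → w ∈ l × adj G v w ≡ true) → (∃ λ w → w ∈ l × adj H v w ≡ true) → ¬ Constant (row G v l)
row-nonconstant {G = G} {H} {v} {l} comp (w , w∈ , vw) (x , x∈ , vx) = λ
  { (inj₁ eq) → true≢false (entry-eq x∈ eq) (co-false (complementary-sym comp) vx)
  ; (inj₂ eq) → true≢false vw (entry-eq w∈ eq) }
  where
  entry-eq : ∀ {b u} → u ∈ l → row G v l ≡ replicate _ b → adj G v u ≡ b
  entry-eq u∈ eq = trans (cong (adj G v) (lookup-index u∈)) (trans (row-lookup G v l (index u∈))
    (trans (cong (λ N → Vec.lookup N (index u∈)) eq) (VecP.lookup-replicate (index u∈) _)))

P₄-represents : {G : Graph n} {S : List (Fin n)} (p : InducedP₄ G S) → Represents G (InducedP₄.vertices p) P₄-adjacency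
P₄-represents {G = G} p = represents-∷ {l = b ∷ c ∷ d ∷ []} _ (λ { zero → ab ; (suc zero) → ac ; (suc (suc zero)) → ad })
  (represents-∷ {l = c ∷ d ∷ []} _ (λ { zero → bc ; (suc zero) → bd })
  (represents-∷ {l = d ∷ []} _ (λ { zero → cd })
  (represents-∷ {l = []} _ (λ ()) (record { entries = λ () }))))
  where open InducedP₄ p

four-vertices : {G H : Graph n} → Complementary G H → (S : List (Fin n)) → Unique S → length S ≡ 4 →
                CutConnected G S → CutConnected H S → Σ (InducedP₄ G S) λ p → S ↭ InducedP₄.vertices p
four-vertices {G = G} comp S u len cG cH = p , perm (⊆⇒↭++ vertices vertices-unique vertices⊆)
  where
  p : InducedP₄ G S
  p = inducedP₄ comp S u (≤-trans (s≤s (s≤s z≤n)) (≤-reflexive (sym len))) cG cH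
  open InducedP₄ p using (vertices; vertices-unique; vertices⊆)
  perm : (∃ λ R → S ↭ vertices ++ R) → S ↭ vertices
  perm ([] , S↭)    = S↭
  perm (r ∷ R , S↭) = ⊥-elim (m+1+n≢m 4 (trans (sym (↭-length S↭)) len))

module _ {G H : Graph n} (comp : Complementary G H) where

  removal-neighbours : {S T : List (Fin n)} {v : Fin n} → Unique S → 2 ≤ length S → CutConnected G S → CutConnected H S →
    S ↭ v ∷ T → Unique (v ∷ T) × (∃ λ w → w ∈ T × adj G v w ≡ true) × (∃ λ w → w ∈ T × adj H v w ≡ true)
  removal-neighbours {T = []}    u 2≤ cG cH S↭ with () ← s≤s⁻¹ (subst (2 ≤_) (↭-length S↭) 2≤)
  removal-neighbours {T = _ ∷ _} u 2≤ cG cH S↭ =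
    uT , neighbour (Unique[x∷xs]⇒x∉xs uT) (here refl) (cutConnected-resp S↭ cG) ,
         neighbour (Unique[x∷xs]⇒x∉xs uT) (here refl) (cutConnected-resp S↭ cH)
    where uT = Unique-resp-↭ S↭ u

  record Five (S : List (Fin n)) : Set where
    field
      {T} : List (Fin n)
      p  : InducedP₄ G T
      v  : Fin n
    l = InducedP₄.vertices p
    N = row G v l
    field
      S↭   : S ↭ v ∷ l
      uniq : Unique (v ∷ l)
      nonconstant : ¬ Constant N
    rep : Represents G (v ∷ l) (consAdjacency N P₄-adjacency)
    rep = represents-∷ N (row-lookup G v l) (P₄-represents p)

  ∃-resp-↭ : {T T′ : List (Fin n)} {P : Fin n → Set} → T ↭ T′ → (∃ λ w → w ∈ T × P w) → ∃ λ w → w ∈ T′ × P w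
  ∃-resp-↭ T↭ (w , w∈ , p) = w , ∈-resp-↭ T↭ w∈ , p

  five-vertices : (S : List (Fin n)) → Unique S → length S ≡ 5 → CutConnected G S → CutConnected H S → Five S
  five-vertices S u len cG cH =
    let v , T , S↭ , cGT , cHT = removable comp S u (≤-reflexive (sym len)) cG cH
        uT , nG , nH = removal-neighbours u (≤-trans (s≤s (s≤s z≤n)) (≤-reflexive (sym len))) cG cH S↭
        p , T↭ = four-vertices comp T (AllPairs.tail uT) (suc-injective (trans (sym (↭-length S↭)) len)) cGT cHT
    in record
      { p = p ; v = v ; S↭ = ↭-trans S↭ (↭-prep v T↭) ; uniq = Unique-resp-↭ (↭-prep v T↭) uT
      ; nonconstant = row-nonconstant comp (∃-resp-↭ T↭ nG) (∃-resp-↭ T↭ nH) }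

  five-bounded : {S : List (Fin n)} (F : Five S) → Bounded G H 10 S ⊎ IsFork (Five.N F) × Bounded G H 11 S
  five-bounded {S} F = cases (check₅ N)
    where
    open Five F
    cases : Constant N ⊎ BoundedBy table₅ 10 (consAdjacency N P₄-adjacency) ⊎
            IsFork N × BoundedBy table₅ 11 (consAdjacency N P₄-adjacency) → Bounded G H 10 S ⊎ IsFork N × Bounded G H 11 S
    cases (inj₁ const)             = ⊥-elim (nonconstant const)
    cases (inj₂ (inj₁ b))          = inj₁ (bounded-↭ (↭-sym S↭) (boundedBy⇒bounded comp uniq rep b))
    cases (inj₂ (inj₂ (fork , b))) = inj₂ (fork , bounded-↭ (↭-sym S↭) (boundedBy⇒bounded comp uniq rep b))

  fork-bounded : {T : List (Fin n)} {x : Fin n} (F : Five T) → IsFork (Five.N F) → Unique (x ∷ T) →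
    (∃ λ w → w ∈ T × adj G x w ≡ true) → (∃ λ w → w ∈ T × adj H x w ≡ true) → Bounded G H 12 (x ∷ T)
  fork-bounded {T} {x} F fork uT nG nH = cases (find fork)
    where
    open Five F hiding (T)
    x↭ : x ∷ T ↭ x ∷ v ∷ l
    x↭ = ↭-prep x S↭
    N′ = row G x (v ∷ l)
    cases : (∃ λ Ft → Ft ∈ forks × N ≡ proj₁ Ft) → Bounded G H 12 (x ∷ T)
    cases ((M , table) , M∈ , eq) = bounded (All.lookup check₆ M∈ N′)
      where
      rep′ : Represents G (x ∷ v ∷ l) (consAdjacency N′ (consAdjacency M P₄-adjacency))
      rep′ = represents-∷ N′ (row-lookup G x (v ∷ l)) (subst (λ N → Represents G (v ∷ l) (consAdjacency N P₄-adjacency)) eq rep)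
      bounded : Constant N′ ⊎ BoundedBy table 12 (consAdjacency N′ (consAdjacency M P₄-adjacency)) → Bounded G H 12 (x ∷ T)
      bounded (inj₁ const) = ⊥-elim (row-nonconstant comp (∃-resp-↭ S↭ nG) (∃-resp-↭ S↭ nH) const)
      bounded (inj₂ b)     = bounded-↭ (↭-sym x↭) (boundedBy⇒bounded comp (Unique-resp-↭ x↭ uT) rep′ b)

  extend-by-removal : {S T : List (Fin n)} {v : Fin n} → Unique S → 5 ≤ length S → CutConnected G S → CutConnected H S →
    S ↭ v ∷ T → CutConnected G T → CutConnected H T → length T ≡ m → Bounded G H (2 * m) T → Bounded G H (2 * suc m) S
  extend-by-removal u 5≤ cG cH S↭ cGT cHT refl b =
    let uT , nG , nH = removal-neighbours u (≤-trans (s≤s (s≤s z≤n)) 5≤) cG cH S↭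
    in bounded-↭ (↭-sym S↭) (extend comp uT (s≤s⁻¹ (subst (5 ≤_) (↭-length S↭) 5≤)) cGT cHT nG nH b)

  upper₅ : (S : List (Fin n)) → Unique S → length S ≡ 5 → CutConnected G S → CutConnected H S → Bounded G H 11 S
  upper₅ S u len cG cH = cases (five-bounded (five-vertices S u len cG cH))
    where
    cases : ∀ {P : Set} → Bounded G H 10 S ⊎ P × Bounded G H 11 S → Bounded G H 11 S
    cases (inj₁ (k , l , 3≤k , 3≤l , k+l≤ , r)) = k , l , 3≤k , 3≤l , m≤n⇒m≤1+n k+l≤ , r
    cases (inj₂ (_ , b)) = b

  -- Remove a vertex. If the remaining five reach 10, the general step gives 12; if not, they form a
  -- fork or its complement and `check₆` covers the whole graph.
  upper₆ : (S : List (Fin n)) → Unique S → length S ≡ 6 → CutConnected G S → CutConnected H S → Bounded G H 12 S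
  upper₆ S u len cG cH =
    let x , T , S↭ , cGT , cHT = removable comp S u 5≤ cG cH
        uT , nG , nH = removal-neighbours u (≤-trans (s≤s (s≤s z≤n)) 5≤) cG cH S↭
        lenT = suc-injective (trans (sym (↭-length S↭)) len)
        F = five-vertices T (AllPairs.tail uT) lenT cGT cHT
    in cases F (five-bounded F) (λ fork → bounded-↭ (↭-sym S↭) (fork-bounded F fork uT nG nH))
         (extend-by-removal u 5≤ cG cH S↭ cGT cHT lenT)
    where
    5≤ : 5 ≤ length S
    5≤ = ≤-trans (n≤1+n 5) (≤-reflexive (sym len))
    cases : ∀ {T} (F : Five T) → Bounded G H 10 T ⊎ IsFork (Five.N F) × Bounded G H 11 T →
            (IsFork (Five.N F) → Bounded G H 12 S) → (Bounded G H 10 T → Bounded G H 12 S) → Bounded G H 12 S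
    cases F (inj₁ b)          _    ten = ten b
    cases F (inj₂ (fork , _)) six  _   = six fork

  upper : (m : ℕ) (S : List (Fin n)) → Unique S → length S ≡ 6 + m → CutConnected G S → CutConnected H S →
          Bounded G H (2 * (6 + m)) S
  upper zero    S u len cG cH = upper₆ S u len cG cH
  upper (suc m) S u len cG cH =
    let x , T , S↭ , cGT , cHT = removable comp S u 5≤ cG cH
        lenT = suc-injective (trans (sym (↭-length S↭)) len)
    in extend-by-removal u 5≤ cG cH S↭ cGT cHT lenT
         (upper m T (AllPairs.tail (Unique-resp-↭ S↭ u)) lenT cGT cHT)
    where
    5≤ : 5 ≤ length S
    5≤ = ≤-trans (m≤m+n 5 (2 + m)) (≤-reflexive (trans (+-suc 5 (suc m)) (sym len)))

-- From colourings to total-colorings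

P₄-colourable : {G : Graph n} {S : List (Fin n)} (p : InducedP₄ G S) → Colourable G 5 (InducedP₄.vertices p)
P₄-colourable {G = G} p = add-pendant a (here refl) (adj-swap G ab) (Colourable-↭ (↭-prep b (↭-swap d c ↭-refl))
  (Sat⇒Colourable (attachAll (b ∷ d ∷ []) (here refl) (adj-swap G bc ∷ cd ∷ []) (singleton-colourable G c))))
  where open InducedP₄ p

last-∷ʳ : (u : Fin n) (ys : List (Fin n)) (w : Fin n) → last (u ∷ ys ∷ʳ w) ≡ just w
last-∷ʳ u []       w = refl
last-∷ʳ u (y ∷ ys) w = last-∷ʳ y ys w

dropLast-∷ʳ : (ys : List (Fin n)) (w : Fin n) → dropLast (ys ∷ʳ w) ≡ ys
dropLast-∷ʳ []           w = refl
dropLast-∷ʳ (y ∷ [])     w = refl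
dropLast-∷ʳ (y ∷ z ∷ ys) w = cong (y ∷_) (dropLast-∷ʳ (z ∷ ys) w)

consec-∷ʳ : {G : Graph n} {u w : Fin n} (ys : List (Fin n)) → All (IsEdge (adj G)) (items u ys w) → Consec G (u ∷ ys ∷ʳ w)
consec-∷ʳ []       (e ∷ [])     = e , tt
consec-∷ʳ (y ∷ ys) (e ∷ _ ∷ es) = e , consec-∷ʳ ys es

mid-unique : {c : Item n → ℕ} {u w : Fin n} (ys : List (Fin n)) → Unique (map c (items u ys w)) → Unique ys
mid-unique [] _ = []
mid-unique {n} {c} {u} {w} (y ∷ ys) (_ ∷ y≢ ∷ r) = All.tabulate (λ { z∈ refl → All.lookup y≢ (∈-map⁺ c (vert∈ y ys z∈)) refl }) ∷ mid-unique ys r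
  where
  vert∈ : ∀ u ys {z} → z ∈ ys → vert z ∈ items u ys w
  vert∈ u (y ∷ ys) (here refl) = there (here refl)
  vert∈ u (y ∷ ys) (there z∈)  = there (there (vert∈ y ys z∈))

-- `TotalRainbow` lists all edges before the internal vertices, whereas `items` interleaves them;
-- distinctness survives the permutation.
colourable⇒TRC : {G : Graph n} → Colourable G k (allFin n) → TRCWith G k
colourable⇒TRC {n} {k} {G} (c , t) = tc , connected
  where
  colF : Item n → Fin k
  colF i = fromℕ< (col<k t i)
  tc : TotalColoring G k
  tc = record { vcol = λ u → colF (vert u) ; ecol = λ u w → colF (edge u w)
              ; ecolSym = λ u w → FinP.toℕ-injective (trans (toℕ-fromℕ< _) (trans (colSym c u w) (sym (toℕ-fromℕ< _)))) }
  colours-↭ : ∀ u ys w → edgeCols tc (u ∷ ys ∷ʳ w) ++ map (vcol tc) ys ↭ map colF (items u ys w)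
  colours-↭ u []       w = ↭-refl
  colours-↭ u (y ∷ ys) w = ↭-prep _ (↭-trans (shift _ (edgeCols tc (y ∷ ys ∷ʳ w)) (map (vcol tc) ys)) (↭-prep _ (colours-↭ y ys w)))
  connected : TotalRainbowConnected tc
  connected u w u≢w = u ∷ mid p ∷ʳ w ,
    ((_ , refl) , last-∷ʳ u (mid p) w , All.tabulate u≢ ∷ UniqueP.++⁺ (mid-unique (mid p) (rainbow p)) ([] ∷ []) disjoint , consec-∷ʳ (mid p) (walk p)) ,
    subst (λ ys → Unique (edgeCols tc (u ∷ mid p ∷ʳ w) ++ map (vcol tc) ys)) (sym (dropLast-∷ʳ (mid p) w))
      (Unique-resp-↭ (↭-sym (colours-↭ u (mid p) w))
        (UniqueP.map⁻ {f = toℕ} (subst Unique (trans (map-cong (λ i → sym (toℕ-fromℕ< (col<k t i))) _) (map-∘ _)) (rainbow p))))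
    where
    p = path t (∈-allFin u) (∈-allFin w) u≢w
    u≢ : ∀ {x} → x ∈ mid p ∷ʳ w → u ≢ x
    u≢ x∈ refl with ∈-++⁻ (mid p) x∈
    ... | inj₁ q           = u∉mid p q
    ... | inj₂ (here refl) = u≢w refl
    disjoint : ∀ {x} → ¬ (x ∈ mid p × x ∈ w ∷ [])
    disjoint (q , here refl) = w∉mid p q

-- Existence of the minimum by decidability

unique⇒length≤ : {xs : List (Fin k)} → Unique xs → length xs ≤ k
unique⇒length≤ {k} {xs} u = subst (length xs ≤_) (length-tabulate {n = k} (λ i → i)) (unique-⊆⇒length≤ u (λ {x} _ → ∈-allFin x))

search-list : (m : ℕ) {P : List (Fin n) → Set} → Decidable P → Dec (∃ λ ps → length ps ≤ m × P ps)
search-list zero    P? = map′ (λ p → [] , z≤n , p) (λ { ([] , _ , p) → p }) (P? [])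
search-list (suc m) P? = map′
  (λ { (inj₁ p) → [] , z≤n , p ; (inj₂ (x , ps , len , p)) → x ∷ ps , s≤s len , p })
  (λ { ([] , _ , p) → inj₁ p ; (x ∷ ps , s≤s len , p) → inj₂ (x , ps , len , p) })
  (P? [] ⊎-dec FinP.any? λ x → search-list m (λ ps → P? (x ∷ ps)))

consec? : (G : Graph n) → Decidable (Consec G)
consec? G []          = yes tt
consec? G (x ∷ [])    = yes tt
consec? G (x ∷ y ∷ r) = (adj G x y Bool.≟ true) ×-dec consec? G (y ∷ r)

isPath? : (G : Graph n) (u v : Fin n) → Decidable (IsPath G u v)
isPath? G u v []       = no λ ()
isPath? G u v (x ∷ ps) = map′ (λ { refl → ps , refl }) (λ { (_ , refl) → refl }) (x ≟ u) ×-dec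
  MaybeP.≡-dec _≟_ (last (x ∷ ps)) (just v) ×-dec DecUnique.unique? _≟_ (x ∷ ps) ×-dec consec? G (x ∷ ps)

-- A path has distinct vertices, hence at most n of them, so searching lists of length up to n is
-- exhaustive.
search-path : (G : Graph n) (u v : Fin n) {P : List (Fin n) → Set} → Decidable P → Dec (∃ λ ps → IsPath G u v ps × P ps)
search-path {n} G u v P? = map′ (λ (ps , _ , p) → ps , p)
  (λ { (ps , p@((_ , _ , uniq , _) , _)) → ps , unique⇒length≤ uniq , p })
  (search-list n λ ps → isPath? G u v ps ×-dec P? ps)

trc? : {G : Graph n} (c : TotalColoring G k) → Dec (TotalRainbowConnected c)
trc? {G = G} c = FinP.all? λ u → FinP.all? λ v → ¬? (u ≟ v) →-dec search-path G u v λ ps → DecUnique.unique? _≟_ _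

trc-cong : {G : Graph n} {c c′ : TotalColoring G k} → (∀ u → vcol c u ≡ vcol c′ u) → (∀ u w → ecol c u w ≡ ecol c′ u w) →
           TotalRainbowConnected c → TotalRainbowConnected c′
trc-cong {c = c} {c′} veq eeq conn u v u≢v with ps , isPath , r ← conn u v u≢v =
  ps , isPath , subst Unique (cong₂ _++_ (edgeCols-cong ps) (map-cong veq (interior ps))) r
  where
  edgeCols-cong : ∀ ps → edgeCols c ps ≡ edgeCols c′ ps
  edgeCols-cong []          = refl
  edgeCols-cong (x ∷ [])    = refl
  edgeCols-cong (x ∷ y ∷ r) = cong₂ _∷_ (eeq x y) (edgeCols-cong (y ∷ r))

-- Constructively, the minimum demanded by `IsTrc` is found by trying each number of colours below
-- one that works, which requires this decision.
trcWith? : (G : Graph n) (k : ℕ) → Dec (TRCWith G k)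
trcWith? {n} G k = map′ (λ { (ec , s , vc , p) → colour ec s vc , p })
  (λ { (c , p) → ecol c , ecolSym c , vcol c , p })
  (search-fun {_≈_ = λ f g → ∀ i → f i ≡ g i} (λ _ → refl) (search-fun refl search-Fin) P P-resp P?)
  where
  colour : (ec : Fin n → Fin n → Fin k) → (∀ u w → ec u w ≡ ec w u) → (Fin n → Fin k) → TotalColoring G k
  colour ec s vc = record { vcol = vc ; ecol = ec ; ecolSym = s }
  P : (Fin n → Fin n → Fin k) → Set
  P ec = Σ (∀ u w → ec u w ≡ ec w u) λ s → ∃ λ vc → TotalRainbowConnected (colour ec s vc)
  P-resp : ∀ {f g} → (∀ u w → f u w ≡ g u w) → P f → P g
  P-resp {f} {g} eq (s , vc , p) =
    s′ , vc , trc-cong {c = colour f s vc} {colour g s′ vc} (λ _ → refl) eq p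
    where
    s′ : ∀ u w → g u w ≡ g w u
    s′ u w = trans (sym (eq u w)) (trans (s u w) (eq w u))
  P? : Decidable P
  P? ec with FinP.all? (λ u → FinP.all? λ w → ec u w ≟ ec w u)
  ... | no ¬s = no (¬s ∘ proj₁)
  -- The symmetry proof is a component of the colouring. Replacing s′ by s changes no colour, so
  -- `trc-cong` applies.
  ... | yes s = map′ (λ (vc , p) → s , vc , p)
    (λ (s′ , vc , p) → vc , trc-cong {c = colour ec s′ vc} {colour ec s vc} (λ _ → refl) (λ _ _ → refl) p)
    (search-fun refl search-Fin (λ vc → TotalRainbowConnected (colour ec s vc))
      (λ {vc} {vc′} eq → trc-cong {c = colour ec s vc} {colour ec s vc′} eq (λ _ _ → refl))
      (λ vc → trc? (colour ec s vc)))

least : {P : ℕ → Set} → Decidable P → ∀ k → P k → ∃ λ a → a ≤ k × P a × (∀ j → j < a → ¬ P j)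
least {P} P? k pk with below (suc k)
  where
  below : ∀ k → (∃ λ a → a < k × P a × (∀ j → j < a → ¬ P j)) ⊎ (∀ j → j < k → ¬ P j)
  below zero = inj₂ λ _ ()
  below (suc k) with below k
  ... | inj₁ (a , a<k , r) = inj₁ (a , m<n⇒m<1+n a<k , r)
  ... | inj₂ none with P? k
  ... | yes p = inj₁ (k , n<1+n k , p , none)
  ... | no ¬p = inj₂ λ j j<1+k → case (m<1+n⇒m<n∨m≡n j<1+k)
    where
    case : ∀ {j} → j < k ⊎ j ≡ k → ¬ P j
    case (inj₁ j<k)  = none _ j<k
    case (inj₂ refl) = ¬p
... | inj₁ (a , a<1+k , r) = a , s≤s⁻¹ a<1+k , r
... | inj₂ none = ⊥-elim (none k (n<1+n k) pk)

isTrc≤ : {G : Graph n} → TRCWith G k → ∃ λ a → a ≤ k × IsTrc G a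
isTrc≤ {k = k} {G} p = least (trcWith? G) k p

bounded⇒isTrc : {G H : Graph n} → Bounded G H m (allFin n) → ∃₂ λ a b → IsTrc G a × IsTrc H b × a + b ≤ m
bounded⇒isTrc (k , l , _ , _ , k+l≤ , tG , tH) =
  let a , a≤ , isA = isTrc≤ (colourable⇒TRC tG)
      b , b≤ , isB = isTrc≤ (colourable⇒TRC tH)
  in a , b , isA , isB , ≤-trans (+-mono-≤ a≤ b≤) k+l≤

-- Lower bounds from long paths

rainbow-length : {G : Graph n} (c : TotalColoring G k) (x y : Fin n) (r : List (Fin n)) →
                 TotalRainbow c (x ∷ y ∷ r) → suc (length r + length r) ≤ k
rainbow-length {k = k} c x y r rb = subst (_≤ k)
  (trans (length-++ (edgeCols c (x ∷ y ∷ r))) (cong₂ _+_ (edges-length x y r) (trans (length-map (vcol c) (interior (x ∷ y ∷ r))) (drop-length y r))))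
  (unique⇒length≤ rb)
  where
  edges-length : ∀ x y r → length (edgeCols c (x ∷ y ∷ r)) ≡ suc (length r)
  edges-length x y []      = refl
  edges-length x y (z ∷ r) = cong suc (edges-length y z r)
  drop-length : ∀ {A : Set} (y : A) r → length (dropLast (y ∷ r)) ≡ length r
  drop-length y []      = refl
  drop-length y (z ∷ r) = cong suc (drop-length z r)

-- A path on at least m + 2 vertices has at least m + 1 edges and m internal vertices, all of
-- different colours.
long-path-bound : {G : Graph n} {u v : Fin n} → u ≢ v →
  (∀ {ps} → IsPath G u v ps → 2 + m ≤ length ps) → TRCWith G k → suc (m + m) ≤ k
long-path-bound {u = u} {v} u≢v long (c , conn) with conn u v u≢v
... | [] , (() , _) , _
... | x ∷ [] , isPath , _ with s≤s () ← long isPath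
... | x ∷ y ∷ r , isPath , rb = ≤-trans (s≤s (+-mono-≤ m≤r m≤r)) (rainbow-length c x y r rb)
  where m≤r = s≤s⁻¹ (s≤s⁻¹ (long isPath))

nonadjacent-bound : {G : Graph n} {u v : Fin n} → u ≢ v → adj G u v ≡ false → TRCWith G k → 3 ≤ k
nonadjacent-bound {G = G} {u} {v} u≢v uv = long-path-bound u≢v long
  where
  long : ∀ {ps} → IsPath G u v ps → 3 ≤ length ps
  long {_ ∷ []}     ((_ , refl) , refl , _) = ⊥-elim (u≢v refl)
  long {_ ∷ _ ∷ []} ((_ , refl) , refl , _ , e , _) = ⊥-elim (true≢false e uv)
  long {_ ∷ _ ∷ _ ∷ _} _ = s≤s (s≤s (s≤s z≤n))

distance-three-bound : {G : Graph n} {u v : Fin n} → u ≢ v → adj G u v ≡ false →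
  (∀ x → adj G u x ≡ true → adj G x v ≡ true → ⊥) → TRCWith G k → 5 ≤ k
distance-three-bound {G = G} {u} {v} u≢v uv noCommon = long-path-bound u≢v long
  where
  long : ∀ {ps} → IsPath G u v ps → 4 ≤ length ps
  long {_ ∷ []}     ((_ , refl) , refl , _) = ⊥-elim (u≢v refl)
  long {_ ∷ _ ∷ []} ((_ , refl) , refl , _ , e , _) = ⊥-elim (true≢false e uv)
  long {_ ∷ x ∷ _ ∷ []} ((_ , refl) , refl , _ , e , e′ , _) = ⊥-elim (noCommon x e e′)
  long {_ ∷ _ ∷ _ ∷ _ ∷ _} _ = s≤s (s≤s (s≤s (s≤s z≤n)))

-- Connectivity by paths and by cuts; four vertices

connected⇒cutConnected : {G : Graph n} → Connected G → CutConnected G (allFin n)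
connected⇒cutConnected {n} {G} conn .cut f {u} {w} _ _ ne = along (conn u w (λ { refl → ne refl }))
  where
  Crossing = ∃₂ λ x y → x ∈ allFin n × y ∈ allFin n × f x ≢ f y × adj G x y ≡ true
  go : ∀ x r → last (x ∷ r) ≡ just w → Consec G (x ∷ r) → f x ≢ f w → Crossing
  go x []      refl _        ne = ⊥-elim (ne refl)
  go x (y ∷ r) l    (e , es) ne with f x Bool.≟ f y
  ... | no q  = x , y , ∈-allFin x , ∈-allFin y , q , e
  ... | yes q = go y r l es (λ eq → ne (trans q eq))
  along : (∃ λ ps → IsPath G u w ps) → Crossing
  along (_ , (r , refl) , l , _ , es) = go u r l es ne

constant⇒cutConnected : {G : Graph n} (z : Fin n) →
  (∀ (f : Fin n → Bool) → (∀ x y → adj G x y ≡ true → f x ≡ f y) → ∀ x → f x ≡ f z) → CutConnected G (allFin n)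
constant⇒cutConnected {n} {G} z const with cutConnected⊎split G (allFin n)
... | inj₁ conn = conn
... | inj₂ (f , (u , w , _ , _ , ne) , uncut) = ⊥-elim (ne (trans (const f same u) (sym (const f same w))))
  where
  same : ∀ x y → adj G x y ≡ true → f x ≡ f y
  same x y e = decidable-stable (f x Bool.≟ f y) (λ q → true≢false e (uncut (∈-allFin x) (∈-allFin y) q))

complement-complementary : (G : Graph n) → Complementary G (complement G)
complement-complementary G .opposite {u} {w} u≢w with u ≟ w
... | yes p = ⊥-elim (u≢w p)
... | no _  = refl

isTrc⇒connected : {G : Graph n} → IsTrc G k → Connected G
isTrc⇒connected ((c , conn) , _) u v u≢v = let ps , isPath , _ = conn u v u≢v in ps , isPath

P₄-spanning-bound : {G : Graph n} (p : InducedP₄ G (allFin n)) → (∀ x → x ∈ InducedP₄.vertices p) → TRCWith G k → 5 ≤ k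
P₄-spanning-bound {G = G} p spanning = distance-three-bound a≢d ad noCommon
  where
  open InducedP₄ p
  noCommon : ∀ x → adj G a x ≡ true → adj G x d ≡ true → ⊥
  noCommon x ax xd with spanning x
  ... | here refl                         = true≢false ax (adjIrrefl G a)
  ... | there (here refl)                 = true≢false xd bd
  ... | there (there (here refl))         = true≢false ax ac
  ... | there (there (there (here refl))) = true≢false ax ad

P₄-isTrc : {G : Graph n} (p : InducedP₄ G (allFin n)) → allFin n ↭ InducedP₄.vertices p → IsTrc G 5
P₄-isTrc p perm = colourable⇒TRC (Colourable-↭ (↭-sym perm) (P₄-colourable p)) ,
  λ j j<5 t → <⇒≱ j<5 (P₄-spanning-bound p (λ x → ∈-resp-↭ perm (∈-allFin x)) t)

-- Sharpness on five vertices

-- 0 and 1 are leaves at 2, which is joined to 4 through 3.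
fork-adjacency : Fin 5 → Fin 5 → Bool
fork-adjacency = consAdjacency (false ∷ true ∷ false ∷ false ∷ []) (consAdjacency (true ∷ false ∷ false ∷ [])
  (consAdjacency (true ∷ false ∷ []) (consAdjacency (true ∷ []) (consAdjacency [] λ ()))))

fork : Graph 5
fork = record
  { adj       = fork-adjacency
  ; adjSym    = toWitness {a? = FinP.all? λ u → FinP.all? λ w → fork-adjacency u w Bool.≟ fork-adjacency w u} _
  ; adjIrrefl = toWitness {a? = FinP.all? λ u → fork-adjacency u u Bool.≟ false} _
  }

pattern v₀ = zero
pattern v₁ = suc zero
pattern v₂ = suc (suc zero)
pattern v₃ = suc (suc (suc zero))
pattern v₄ = suc (suc (suc (suc zero)))

fork-cutConnected : CutConnected fork (allFin 5)
fork-cutConnected = constant⇒cutConnected v₂ λ f same → λ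
  { v₀ → same v₀ v₂ refl ; v₁ → same v₁ v₂ refl ; v₂ → refl ; v₃ → same v₃ v₂ refl
  ; v₄ → trans (same v₄ v₃ refl) (same v₃ v₂ refl) }

fork-complement-cutConnected : CutConnected (complement fork) (allFin 5)
fork-complement-cutConnected = constant⇒cutConnected v₀ λ f same → λ
  { v₀ → refl ; v₁ → same v₁ v₀ refl ; v₂ → trans (same v₂ v₄ refl) (same v₄ v₀ refl) ; v₃ → same v₃ v₀ refl
  ; v₄ → same v₄ v₀ refl }

-- In the complement the only neighbour of 2 is 4, which is not joined to 3, so 2 and 3 have
-- distance at least three.
fork-complement-bound : TRCWith (complement fork) k → 5 ≤ k
fork-complement-bound = distance-three-bound {u = v₂} {v₃} (λ ()) refl
  λ { v₀ () _ ; v₁ () _ ; v₂ () _ ; v₃ () _ ; v₄ _ () }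

-- The implicit argument is filled by evaluation: an exhaustive search finds no path other than
-- `qs`.
only-path : {u v : Fin 5} (qs : List (Fin 5)) →
  {_ : False (search-path fork u v (λ ps → ¬? (≡-dec _≟_ ps qs)))} → ∀ {ps} → IsPath fork u v ps → ps ≡ qs
only-path qs {none} {ps} isPath = decidable-stable (≡-dec _≟_ ps qs) λ ne → toWitnessFalse none (ps , isPath , ne)

-- The path 0, 2, 3, 4 shows five colours. The edge 12 has a sixth: the path 1, 2, 3, 4 separates it
-- from four of them, and the path 0, 2, 1 from the colour of 02.
fork-bound : TRCWith fork k → 6 ≤ k
fork-bound {k} (c , conn) = distinct
  (rainbow-along {v₀} {v₄} (v₀ ∷ v₂ ∷ v₃ ∷ v₄ ∷ []) (only-path _) (λ ()))
  (rainbow-along {v₁} {v₄} (v₁ ∷ v₂ ∷ v₃ ∷ v₄ ∷ []) (only-path _) (λ ()))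
  (rainbow-along {v₀} {v₁} (v₀ ∷ v₂ ∷ v₁ ∷ []) (only-path _) (λ ()))
  where
  rainbow-along : ∀ {u v} qs → (∀ {ps} → IsPath fork u v ps → ps ≡ qs) → u ≢ v → TotalRainbow c qs
  rainbow-along {u} {v} qs only u≢v = let ps , isPath , r = conn u v u≢v in subst (TotalRainbow c) (only isPath) r
  distinct : TotalRainbow c (v₀ ∷ v₂ ∷ v₃ ∷ v₄ ∷ []) → TotalRainbow c (v₁ ∷ v₂ ∷ v₃ ∷ v₄ ∷ []) →
             TotalRainbow c (v₀ ∷ v₂ ∷ v₁ ∷ []) → 6 ≤ k
  distinct u (e₁ ∷ _) ((e₀₁ ∷ _) ∷ _) = unique⇒length≤
    (((λ eq → e₀₁ (sym (trans (ecolSym c v₂ v₁) eq))) ∷ e₁) ∷ u)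

-- Sharpness from six vertices on: the path and its complement

consecutive? : (i j : Fin n) → Dec (suc (toℕ i) ≡ toℕ j ⊎ suc (toℕ j) ≡ toℕ i)
consecutive? i j = (suc (toℕ i) ℕ.≟ toℕ j) ⊎-dec (suc (toℕ j) ℕ.≟ toℕ i)

pathGraph : (n : ℕ) → Graph n
pathGraph n = record
  { adj       = λ i j → does (consecutive? i j)
  ; adjSym    = λ i j → ∨-comm (does (suc (toℕ i) ℕ.≟ toℕ j)) _
  ; adjIrrefl = λ i → dec-false (consecutive? i i) λ { (inj₁ p) → 1+n≢n p ; (inj₂ p) → 1+n≢n p }
  }

path-step : (i j : Fin n) → adj (pathGraph n) i j ≡ true → toℕ j ≤ suc (toℕ i)
path-step i j e = step (consecutive? i j) e
  where
  step : (d : Dec (suc (toℕ i) ≡ toℕ j ⊎ suc (toℕ j) ≡ toℕ i)) → does d ≡ true → toℕ j ≤ suc (toℕ i)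
  step (yes (inj₁ p)) _ = ≤-reflexive (sym p)
  step (yes (inj₂ p)) _ = ≤-trans (n≤1+n _) (≤-trans (≤-reflexive p) (n≤1+n _))

path-adjacent : (i j : Fin n) → suc (toℕ i) ≡ toℕ j → adj (pathGraph n) i j ≡ true
path-adjacent i j eq = dec-true (consecutive? i j) (inj₁ eq)

path-nonadjacent : (i j : Fin n) → 2 + toℕ i ≤ toℕ j → adj (complement (pathGraph n)) i j ≡ true
path-nonadjacent {n} i j i+2≤j = co-true (complement-complementary (pathGraph n)) {i} {j}
  (λ i≡j → <⇒≢ (≤-trans (n≤1+n _) i+2≤j) (cong toℕ i≡j))
  (dec-false (consecutive? i j) λ { (inj₁ p) → <⇒≢ i+2≤j p ; (inj₂ p) → <⇒≱ (≤-trans (n≤1+n _) i+2≤j) (≤-trans (n≤1+n _) (≤-reflexive p)) })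

path-cutConnected : CutConnected (pathGraph (suc m)) (allFin (suc m))
path-cutConnected = constant⇒cutConnected zero λ f same → <-weakInduction (λ i → f i ≡ f zero) refl λ i eq →
  trans (sym (same (inject₁ i) (suc i) (path-adjacent (inject₁ i) (suc i) (cong suc (toℕ-inject₁ i))))) eq

path-complement-cutConnected : CutConnected (complement (pathGraph (4 + m))) (allFin (4 + m))
path-complement-cutConnected {m} = constant⇒cutConnected zero λ f same →
  let far : ∀ i → f (suc (suc i)) ≡ f zero
      far i = sym (same zero (suc (suc i)) (path-nonadjacent {4 + m} zero (suc (suc i)) (s≤s (s≤s z≤n))))
  in λ { zero          → refl
       ; (suc zero)    → trans (same v₁ v₃ (path-nonadjacent {4 + m} v₁ v₃ ≤-refl)) (far (suc zero))
       ; (suc (suc i)) → far i }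

-- An edge raises the index by at most one, so a path from 0 to m + 1 visits at least m + 2
-- vertices.
path-bound : TRCWith (pathGraph (2 + m)) k → suc (m + m) ≤ k
path-bound {m} = long-path-bound {u = zero} {v = fromℕ (suc m)} (λ ()) long
  where
  reach : ∀ x r {w} → last (x ∷ r) ≡ just w → Consec (pathGraph (2 + m)) (x ∷ r) → toℕ w ≤ toℕ x + length r
  reach x []      refl _        = ≤-reflexive (sym (+-identityʳ (toℕ x)))
  reach x (y ∷ r) l    (e , es) = ≤-trans (reach y r l es)
    (≤-trans (+-monoˡ-≤ (length r) (path-step x y e)) (≤-reflexive (sym (+-suc (toℕ x) (length r)))))
  long : ∀ {ps} → IsPath (pathGraph (2 + m)) zero (fromℕ (suc m)) ps → 2 + m ≤ length ps
  long ((r , refl) , l , _ , es) = s≤s (subst (_≤ length r) (toℕ-fromℕ (suc m)) (reach zero r l es))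

path-complement-bound : TRCWith (complement (pathGraph (2 + m))) k → 3 ≤ k
path-complement-bound {m} = nonadjacent-bound {u = zero} {suc zero} (λ ())
  (co-false (complement-complementary (pathGraph (2 + m))) {zero} {suc zero} (path-adjacent {2 + m} zero (suc zero) refl))

-- Assembling the bounds

UpperBound : Set
UpperBound = (n : ℕ) → 4 ≤ n → (G : Graph n) → Connected G → Connected (complement G) →
  Σ ℕ λ a → Σ ℕ λ b → IsTrc G a × IsTrc (complement G) b ×
    (n ≡ 4 → a + b ≡ 2 * n + 2) × (n ≡ 5 → a + b ≤ 2 * n + 1) × (6 ≤ n → a + b ≤ 2 * n)

upper-bound : UpperBound
upper-bound 1 (s≤s ())
upper-bound 2 (s≤s (s≤s ()))
upper-bound 3 (s≤s (s≤s (s≤s ())))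
upper-bound 4 _ G cG cH =
  let comp   = complement-complementary G
      p , S↭ = four-vertices comp (allFin 4) (UniqueP.allFin⁺ 4) refl (connected⇒cutConnected cG) (connected⇒cutConnected cH)
  in 5 , 5 , P₄-isTrc p S↭ , P₄-isTrc (P₄-complement comp p) (↭-trans S↭ (↭-sym (P₄-complement-vertices comp p))) ,
     (λ _ → refl) , (λ ()) , λ 6≤4 → ⊥-elim (<⇒≱ 6≤4 (n≤1+n 4))
upper-bound 5 _ G cG cH =
  let a , b , isA , isB , a+b≤ = bounded⇒isTrc (upper₅ (complement-complementary G) (allFin 5) (UniqueP.allFin⁺ 5) refl
                                   (connected⇒cutConnected cG) (connected⇒cutConnected cH))
  in a , b , isA , isB , (λ ()) , (λ _ → a+b≤) , λ 6≤5 → ⊥-elim (<⇒≱ 6≤5 ≤-refl)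
upper-bound (suc (suc (suc (suc (suc (suc m)))))) _ G cG cH =
  let a , b , isA , isB , a+b≤ = bounded⇒isTrc (upper (complement-complementary G) m (allFin (6 + m)) (UniqueP.allFin⁺ (6 + m))
                                   (length-tabulate {n = 6 + m} (λ i → i)) (connected⇒cutConnected cG) (connected⇒cutConnected cH))
  in a , b , isA , isB , (λ ()) , (λ ()) , λ _ → a+b≤

Sharpness : Set
Sharpness = (n : ℕ) → 5 ≤ n → Σ (Graph n) λ G → Connected G × Connected (complement G) ×
  Σ ℕ λ a → Σ ℕ λ b → IsTrc G a × IsTrc (complement G) b × (n ≡ 5 → a + b ≡ 2 * n + 1) × (6 ≤ n → a + b ≡ 2 * n)

sharpness : Sharpness
sharpness 1 (s≤s ())
sharpness 2 (s≤s (s≤s ()))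
sharpness 3 (s≤s (s≤s (s≤s ())))
sharpness 4 (s≤s (s≤s (s≤s (s≤s ()))))
sharpness 5 _ =
  let a , b , isA , isB , a+b≤ = bounded⇒isTrc (upper₅ (complement-complementary fork) (allFin 5) (UniqueP.allFin⁺ 5) refl
                                   fork-cutConnected fork-complement-cutConnected)
  in fork , isTrc⇒connected isA , isTrc⇒connected isB , a , b , isA , isB ,
     -- The lower bounds 6 and 5 meet the upper bound 11.
     (λ _ → ≤-antisym a+b≤ (+-mono-≤ (fork-bound (proj₁ isA)) (fork-complement-bound (proj₁ isB)))) ,
     λ 6≤5 → ⊥-elim (<⇒≱ 6≤5 ≤-refl)
sharpness (suc (suc (suc (suc (suc (suc m)))))) _ =
  let P = pathGraph (6 + m)
      a , b , isA , isB , a+b≤ = bounded⇒isTrc (upper (complement-complementary P) m (allFin (6 + m)) (UniqueP.allFin⁺ (6 + m))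
                                   (length-tabulate {n = 6 + m} (λ i → i)) path-cutConnected path-complement-cutConnected)
  in P , isTrc⇒connected isA , isTrc⇒connected isB , a , b , isA , isB , (λ ()) ,
     -- The lower bounds 2n - 3 and 3 add up to the general upper bound 2n, which forces equality
     -- without exhibiting colourings.
     λ _ → ≤-antisym a+b≤ (≤-trans (≤-reflexive (total m)) (+-mono-≤ (path-bound (proj₁ isA)) (path-complement-bound {4 + m} (proj₁ isB))))
  where
  total : ∀ m → 2 * (6 + m) ≡ suc ((4 + m) + (4 + m)) + 3
  total = solve 1 (λ m → con 2 :* (con 6 :+ m) := con 1 :+ ((con 4 :+ m) :+ (con 4 :+ m)) :+ con 3) refl
    where open +-*-Solver

theorem4p5 : ((n : ℕ) → 4 ≤ n → (G : Graph n) → Connected G → Connected (complement G) →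
    Σ ℕ λ a → Σ ℕ λ b → IsTrc G a × IsTrc (complement G) b ×
    (n ≡ 4 → a + b ≡ 2 * n + 2) ×
    (n ≡ 5 → a + b ≤ 2 * n + 1) ×
    (6 ≤ n → a + b ≤ 2 * n))
    ×
    ((n : ℕ) → 5 ≤ n →
    Σ (Graph n) λ G → Connected G × Connected (complement G) ×
    Σ ℕ λ a → Σ ℕ λ b → IsTrc G a × IsTrc (complement G) b ×
    (n ≡ 5 → a + b ≡ 2 * n + 1) ×
    (6 ≤ n → a + b ≡ 2 * n))
theorem4p5 = upper-bound , sharpness
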